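{- Let $\mathcal{M}=(\mathcal{M}_n)_{n\geq 2}$ be a $2$-rigidity family with $\mathcal{M}\neq\mathcal{R}$. Then $K_{3,3}$ is an $\mathcal{M}$-circuit.
   Context: Graphs are identified with their edge sets (no isolated vertices); a graph on $[n]$ is a subset of $\binom{[n]}{2}$. A graph matroid $\mathcal{M}_n$ (a matroid on ground set $\binom{[n]}{2}$) is symmetric if independence is invariant under relabelling the vertices. A sequence $\mathcal{M}=(\mathcal{M}_n)_{n\geq 2}$ of symmetric graph matroids is a matroidal family if every graph $G\subseteq\binom{\mathbb{N}}{2}$ that is $\mathcal{M}_n$-independent for some $n$ is $\mathcal{M}_n$-independent for all $n\geq v(G)$ (the number of vertices of $G$); one then speaks of $G$ being $\mathcal{M}$-independent/dependent/a circuit. A $2$-rigidity family is a matroidal family in which each $\mathcal{M}_n$ has rank $2n-3$. The family $\mathcal{R}=(\mathcal{R}_n)$ is defined by: $G\subseteq\binom{[n]}{2}$ is $\mathcal{R}_n$-independent iff every set of $m$ vertices, $2\leq m\leq n$, induces at most $2m-3$ edges of $G$. -}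

module Defs where

open import Data.Nat as ℕ using (ℕ; zero; suc; _+_; _*_; _∸_)
import Data.Nat.Properties as ℕP
open import Data.Fin using (Fin; toℕ; fromℕ<; _<_)
open import Data.Fin.Properties using (_<?_; <-cmp)
open import Data.Fin.Permutation using (Permutation′; _⟨$⟩ʳ_)
open import Data.Fin.Subset using (Subset; _∈_; ∣_∣)
open import Data.Vec using (lookup)
open import Data.Bool using (Bool; true; false; if_then_else_; _∧_)
open import Data.List using (List; []; _∷_; [_]; concatMap; map; allFin)
open import Data.Nat.ListAction using (sum)
open import Data.Product using (Σ; Σ-syntax; ∃; ∃-syntax; _×_; _,_)
open import Data.Sum using (_⊎_)
open import Relation.Binary.PropositionalEquality using (_≡_)
open import Relation.Binary.Definitions using (tri<; tri≈; tri>)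
open import Relation.Nullary using (yes; no; ¬_)
open import Function.Bundles using (_⇔_)

Edge : ℕ → Set
Edge n = Σ[ i ∈ Fin n ] Σ[ j ∈ Fin n ] i < j

Graph : ℕ → Set
Graph n = Edge n → Bool

edgeIf : ∀ {n} → Fin n → Fin n → List (Edge n)
edgeIf i j with i <? j
... | yes p = [ (i , j , p) ]
... | no _  = []

allEdges : (n : ℕ) → List (Edge n)
allEdges n = concatMap (λ i → concatMap (λ j → edgeIf i j) (allFin n)) (allFin n)

card : ∀ {n} → Graph n → ℕ
card {n} G = sum (map (λ e → if G e then 1 else 0) (allEdges n))

_⊆G_ : ∀ {n} → Graph n → Graph n → Set
A ⊆G B = ∀ e → A e ≡ true → B e ≡ true

hasEdge : ∀ {n} → Graph n → Fin n → Fin n → Bool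
hasEdge G i j with <-cmp i j
... | tri< p _ _ = G (i , j , p)
... | tri≈ _ _ _ = false
... | tri> _ _ p = G (j , i , p)

relabel : ∀ {n} → Permutation′ n → Graph n → Graph n
relabel σ G (i , j , _) = hasEdge G (σ ⟨$⟩ʳ i) (σ ⟨$⟩ʳ j)

embed : ∀ {m n} → Graph m → Graph n
embed {m} G (i , j , _) with toℕ i ℕ.<? m | toℕ j ℕ.<? m
... | yes a | yes b = hasEdge G (fromℕ< a) (fromℕ< b)
... | _     | _     = false

record GraphMatroid (n : ℕ) : Set₁ where
  field
    Indep : Graph n → Set
    Indep-resp : ∀ {A B} → (∀ e → A e ≡ B e) → Indep A → Indep B
    Indep-∅ : Indep (λ _ → false)
    Indep-⊆ : ∀ {A B} → A ⊆G B → Indep B → Indep A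
    Indep-aug : ∀ {A B} → Indep A → Indep B → card A ℕ.< card B →
      ∃[ e ] (B e ≡ true × A e ≡ false ×
        (∀ C → (∀ x → (C x ≡ true) ⇔ (A x ≡ true ⊎ x ≡ e)) → Indep C))

open GraphMatroid public

IsCircuit : ∀ {n} → GraphMatroid n → Graph n → Set
IsCircuit M C = ¬ Indep M C ×
  (∀ D → D ⊆G C → (∃[ e ] (C e ≡ true × D e ≡ false)) → Indep M D)

-- A 2-rigidity family; M k is the matroid 𝓜_{k+2} (so n = k + 2 ≥ 2).
record RigidityFamily2 : Set₁ where
  field
    M : (k : ℕ) → GraphMatroid (2 + k)
    symmetric : ∀ k (σ : Permutation′ (2 + k)) (G : Graph (2 + k)) →
      Indep (M k) G ⇔ Indep (M k) (relabel σ G)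
    matroidal : ∀ k l → k ℕ.≤ l → (G : Graph (2 + k)) →
      Indep (M k) G ⇔ Indep (M l) (embed G)
    rank-attained : ∀ k → ∃[ G ] (Indep (M k) G × card G ≡ 2 * (2 + k) ∸ 3)
    rank-bound : ∀ k (G : Graph (2 + k)) → Indep (M k) G → card G ℕ.≤ 2 * (2 + k) ∸ 3

open RigidityFamily2 public

induced : ∀ {n} → Graph n → Subset n → ℕ
induced G S = card (λ { (i , j , p) → lookup S i ∧ lookup S j ∧ G (i , j , p) })

RIndep : ∀ {n} → Graph n → Set
RIndep {n} G = ∀ (S : Subset n) → 2 ℕ.≤ ∣ S ∣ → induced G S ℕ.≤ 2 * ∣ S ∣ ∸ 3

EqualsR : RigidityFamily2 → Set
EqualsR F = ∀ k (G : Graph (2 + k)) → Indep (M F k) G ⇔ RIndep G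

K33 : Graph 6
K33 (i , j , _) with toℕ i ℕ.<? 3 | toℕ j ℕ.<? 3
... | yes _ | no _ = true
... | _     | _    = false

{-# OPTIONS --safe #-}

-- Independence in M implies the sparsity count of R by the rank bound on vertex subsets, so the
-- point is that if K₃,₃ is M-independent then every sparse graph is M-independent. Sparse graphs
-- are built by 0- and 1-extensions (Henneberg). 0-extensions preserve independence in every
-- 2-rigidity family. For a 1-extension that replaces the edge ab of a basis B by a new vertex v
-- joined to a, b, c, take two further new vertices u, w and join each of u, v, w to a and b. Together
-- with B − ab this gives an independent set A that is one edge short of a basis. By the rank of K₆,
-- the K₃,₃ on {a,b,c} ∪ {u,v,w} extends to a basis by edges of A only, never by ab; so one of uc,
-- vc, wc can be added to A, and by symmetry it may be taken to be vc.

module Submission where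

open import Defs
open import Level using (Level)
open import Data.Bool using (Bool; true; false; if_then_else_; _∧_; _∨_)
import Data.Bool.Properties as Bool
open import Data.Empty using (⊥; ⊥-elim)
open import Data.Fin using (Fin; toℕ; fromℕ<)
import Data.Fin.Properties as Fin
open import Data.Fin.Permutation using (_⟨$⟩ʳ_; transpose)
open import Data.List using (List; []; _∷_; _++_; length; map; filter; concatMap; allFin; upTo; downFrom; applyUpTo; lookup)
open import Data.List.Properties using (length-map; map-cong; map-∘; map-id-local; map-cong-local; length-++; map-++; length-upTo)
open import Data.List.Membership.Propositional using (_∈_; _∉_; find; lose)
open import Data.List.Membership.Propositional.Properties using (∈-map⁺; ∈-map⁻; ∈-filter⁺; ∈-filter⁻; ∈-concatMap⁺; ∈-concatMap⁻; ∈-allFin; ∈-∃++; ∈-++⁺ˡ; ∈-++⁺ʳ; ∈-++⁻; ∈-upTo⁺; ∈-downFrom⁺; ∈-downFrom⁻; ∈-lookup)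
open import Data.List.Relation.Binary.Subset.Propositional using (_⊆_)
import Data.List.Relation.Binary.Subset.Propositional.Properties as Subset
open import Data.List.Relation.Unary.All as All using (All; []; _∷_)
import Data.List.Relation.Unary.All.Properties as All
open import Data.List.Relation.Unary.AllPairs as AllPairs using (AllPairs; []; _∷_)
import Data.List.Relation.Unary.AllPairs.Properties as AllPairs
open import Data.List.Relation.Unary.Any using (here; there; satisfied)
import Data.List.Relation.Unary.Any as Any
open import Data.List.Relation.Unary.Unique.Propositional using (Unique)
import Data.List.Relation.Unary.Unique.Propositional.Properties as Unique
open import Data.Nat
open import Data.Nat.ListAction using (sum)
open import Data.Nat.Properties
open import Data.Product using (Σ-syntax; ∃-syntax; _×_; _,_; proj₁; proj₂)
open import Data.Product.Properties using (≡-dec)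
open import Data.Sum using (_⊎_; inj₁; inj₂; [_,_]′)
open import Function using (_∘_; id; case_of_; mk⇔; Equivalence; _⇔_)
open import Relation.Binary.Definitions using (tri<; tri≈; tri>)
open import Relation.Binary.PropositionalEquality hiding ([_])
open import Relation.Nullary using (¬_; _×-dec_; Dec; yes; no; does)
open import Relation.Nullary.Decidable using (True; toWitness; dec-true; dec-false; from-yes; ¬?)
open import Relation.Nullary.Negation using (contradiction)
open import Data.Nat.Tactic.RingSolver using (solve-∀)
open import Data.List.Relation.Binary.Permutation.Propositional using (_↭_; ↭-sym; ↭-refl; ↭-trans; prep; ↭⇒↭ₛ)
open import Data.List.Relation.Binary.Permutation.Propositional.Properties using (∈-resp-↭; All-resp-↭; shift; map⁺; ↭-length)
open import Data.Nat.ListAction.Properties using (sum-↭; sum-++)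
open import Data.List.Relation.Binary.Permutation.Setoid.Properties using (Unique-resp-↭)
open import Data.Fin.Subset using (Subset; ∣_∣)
open import Data.Vec as Vec using ([]; _∷_)
import Data.Vec.Properties as Vec
open import Data.List.Membership.DecPropositional (≡-dec _≟_ _≟_) using (_∈?_)

-- The 0-extension rests on a spanning argument: a basis on `V` leaves no room for a further edge
-- inside `V`, so its completion to a basis on `v ∷ V` consists of exactly two edges at `v`.
-- Transpositions then move their ends to any prescribed pair, since one basis on `V` may be
-- exchanged for another.
--
-- A sparse graph has a vertex of degree at most three. Degree three is the critical case: after its
-- deletion some two neighbours must be joined so that sparsity survives. A pair is obstructed
-- exactly when a tight set contains it. If all three pairs were obstructed, the tight sets would
-- combine into one tight set containing all three neighbours, and restoring the deleted vertex
-- would violate sparsity.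
--
-- Minimality of the circuit is a separate matter and holds in every family: K₃,₃ minus an edge is
-- reached from the empty graph by 0-extensions alone.
--
-- Independence is not assumed decidable. New edges always come from the augmentation axiom, and
-- case distinctions concern only membership, sizes and the finite search for tight sets.

private variable
  ℓ : Level
  A : Set ℓ
  n : ℕ

-- A graph on vertices in ℕ is a duplicate-free list of pairs (i , j) with i < j.
E : Set
E = ℕ × ℕ

⟪_,_⟫ : ℕ → ℕ → E
⟪ i , j ⟫ = i ⊓ j , i ⊔ j

Within : ℕ → E → Set
Within n (i , j) = i < j × j < n

Unique-⊆⇒length≤ : ∀ {xs ys : List A} → Unique xs → xs ⊆ ys → length xs ≤ length ys
Unique-⊆⇒length≤ {xs = []} _ _ = z≤n
Unique-⊆⇒length≤ {xs = x ∷ xs} u@(_ ∷ u′) xs⊆ with us , vs , refl ← ∈-∃++ (xs⊆ (here refl)) =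
  subst (suc (length xs) ≤_) (sym (trans (length-++ us) (trans (+-suc _ _) (cong suc (sym (length-++ us))))))
    (s≤s (Unique-⊆⇒length≤ u′ λ {y} y∈ → remove y∈ (∈-++⁻ us (xs⊆ (there y∈)))))
  where
  remove : ∀ {y} → y ∈ xs → y ∈ us ⊎ y ∈ x ∷ vs → y ∈ us ++ vs
  remove y∈ (inj₁ p) = ∈-++⁺ˡ p
  remove y∈ (inj₂ (here refl)) = contradiction y∈ (Unique.Unique[x∷xs]⇒x∉xs u)
  remove y∈ (inj₂ (there p)) = ∈-++⁺ʳ us p

Unique-length : ∀ {xs ys : List A} → Unique xs → Unique ys → xs ⊆ ys → ys ⊆ xs → length xs ≡ length ys
Unique-length u v p q = ≤-antisym (Unique-⊆⇒length≤ u p) (Unique-⊆⇒length≤ v q)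

-- Graphs as edge lists

toE : Edge n → E
toE (i , j , _) = toℕ i , toℕ j

toE-injective : {e f : Edge n} → toE e ≡ toE f → e ≡ f
toE-injective {e = i , j , p} {i′ , j′ , p′} eq
  with refl ← Fin.toℕ-injective (cong proj₁ eq) | refl ← Fin.toℕ-injective (cong proj₂ eq)
  = cong (λ q → i , j , q) (<-irrelevant p p′)

toE-within : (e : Edge n) → Within n (toE e)
toE-within (i , j , p) = p , Fin.toℕ<n j

fromE : ∀ {x} → Within n x → Σ[ e ∈ Edge n ] toE e ≡ x
fromE {n} {i , j} (p , q) =
  (fromℕ< i<n , fromℕ< q , subst₂ _<_ (sym (Fin.toℕ-fromℕ< i<n)) (sym (Fin.toℕ-fromℕ< q)) p)
  , cong₂ _,_ (Fin.toℕ-fromℕ< i<n) (Fin.toℕ-fromℕ< q)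
  where i<n = <-trans p q

∈-edgeIf⁻ : ∀ {i j : Fin n} {e} → e ∈ edgeIf i j → proj₁ e ≡ i × proj₁ (proj₂ e) ≡ j
∈-edgeIf⁻ {i = i} {j} e∈ with i Fin.<? j
∈-edgeIf⁻ (here refl) | yes _ = refl , refl

∈-allEdges : (e : Edge n) → e ∈ allEdges n
∈-allEdges {n} (i , j , p) =
  ∈-concatMap⁺ _ (Any.map (λ { refl → ∈-concatMap⁺ _ (Any.map (λ { refl → self }) (∈-allFin j)) }) (∈-allFin i))
  where
  self : (i , j , p) ∈ edgeIf i j
  self with i Fin.<? j
  ... | yes q = here (cong (λ r → i , j , r) (<-irrelevant p q))
  ... | no ¬q = contradiction p ¬q

concatMap-unique : ∀ {b} {B : Set b} (f : A → List B) {xs} → Unique xs → (∀ x → Unique (f x)) →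
  (∀ {x y z} → z ∈ f x → z ∈ f y → x ≡ y) → Unique (concatMap f xs)
concatMap-unique f u uf inj = Unique.concat⁺ (All.map⁺ (All.universal uf _))
  (AllPairs.map⁺ (AllPairs.map (λ x≢y {_} (p , q) → x≢y (inj p q)) u))

allEdges-unique : ∀ n → Unique (allEdges n)
allEdges-unique n = concatMap-unique _ (Unique.allFin⁺ n)
  (λ i → concatMap-unique _ (Unique.allFin⁺ n) edgeIf-unique
    λ p q → trans (sym (proj₂ (∈-edgeIf⁻ p))) (proj₂ (∈-edgeIf⁻ q)))
  (λ p q → trans (sym (row p)) (row q))
  where
  edgeIf-unique : ∀ {i} j → Unique (edgeIf i j)
  edgeIf-unique {i} j with i Fin.<? j
  ... | yes _ = [] ∷ []
  ... | no _ = []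
  row : ∀ {i e} → e ∈ concatMap (edgeIf i) (allFin n) → proj₁ e ≡ i
  row {i} p with j , q ← satisfied (∈-concatMap⁻ (edgeIf i) {xs = allFin n} p) = proj₁ (∈-edgeIf⁻ {j = j} q)

graph : ∀ n → List E → Graph n
graph n L e = does (toE e ∈? L)

∈⇒graph : ∀ {L} (e : Edge n) → toE e ∈ L → graph n L e ≡ true
∈⇒graph {L = L} e = dec-true (toE e ∈? L)

∉⇒graph : ∀ {L} (e : Edge n) → toE e ∉ L → graph n L e ≡ false
∉⇒graph {L = L} e = dec-false (toE e ∈? L)

graph⇒∈ : ∀ {L} (e : Edge n) → graph n L e ≡ true → toE e ∈ L
graph⇒∈ {L = L} e p with toE e ∈? L
... | yes q = q

graph⇒∉ : ∀ {L} (e : Edge n) → graph n L e ≡ false → toE e ∉ L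
graph⇒∉ e p q with () ← trans (sym p) (∈⇒graph e q)

Bool-ext : ∀ {b c : Bool} → (b ≡ true → c ≡ true) → (c ≡ true → b ≡ true) → b ≡ c
Bool-ext {true} p q = sym (p refl)
Bool-ext {false} {true} p q = q refl
Bool-ext {false} {false} p q = refl

edgesOf : Graph n → List E
edgesOf G = map toE (filter (λ e → G e Bool.≟ true) (allEdges _))

∈-edgesOf⁺ : (G : Graph n) (e : Edge n) → G e ≡ true → toE e ∈ edgesOf G
∈-edgesOf⁺ G e p = ∈-map⁺ toE (∈-filter⁺ _ (∈-allEdges e) p)

∈-edgesOf⁻ : (G : Graph n) {x : E} → x ∈ edgesOf G → Σ[ e ∈ Edge n ] x ≡ toE e × G e ≡ true
∈-edgesOf⁻ G x∈ with e , e∈ , eq ← ∈-map⁻ toE x∈ = e , eq , proj₂ (∈-filter⁻ (λ f → G f Bool.≟ true) {xs = allEdges _} e∈)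

edgesOf-unique : (G : Graph n) → Unique (edgesOf G)
edgesOf-unique G = Unique.map⁺ toE-injective (Unique.filter⁺ _ (allEdges-unique _))

edgesOf-within : (G : Graph n) → All (Within n) (edgesOf G)
edgesOf-within G = All.tabulate λ x∈ → case ∈-edgesOf⁻ G x∈ of λ { (e , refl , _) → toE-within e }

graph-edgesOf : (G : Graph n) → ∀ e → G e ≡ graph n (edgesOf G) e
graph-edgesOf G e = Bool-ext (∈⇒graph e ∘ ∈-edgesOf⁺ G e)
  λ p → case ∈-edgesOf⁻ G (graph⇒∈ e p) of λ { (f , eq , q) → trans (cong G (toE-injective eq)) q }

card≡length : (G : Graph n) → card G ≡ length (edgesOf G)
card≡length {n} G = trans (count (allEdges n)) (sym (length-map toE (filter (λ e → G e Bool.≟ true) (allEdges n))))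
  where
  count : ∀ xs → sum (map (λ e → if G e then 1 else 0) xs) ≡ length (filter (λ e → G e Bool.≟ true) xs)
  count [] = refl
  count (x ∷ xs) with G x
  ... | true = cong suc (count xs)
  ... | false = count xs

card-graph : ∀ {L} → Unique L → All (Within n) L → card (graph n L) ≡ length L
card-graph {n} {L} u w = trans (card≡length (graph n L)) (Unique-length (edgesOf-unique (graph n L)) u
  (λ x∈ → let e , eq , p = ∈-edgesOf⁻ (graph n L) x∈ in subst (_∈ L) (sym eq) (graph⇒∈ e p))
  (λ x∈ → let e , eq = fromE (All.lookup w x∈) in
    subst (_∈ edgesOf (graph n L)) eq (∈-edgesOf⁺ (graph n L) e (∈⇒graph e (subst (_∈ L) (sym eq) x∈)))))

-- With edges named by pairs of naturals, `embed` becomes the identity on edge lists. This is what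
-- allows `Ind` to hide its level.
embed-graph : ∀ {m n L} → All (Within m) L → ∀ e → embed {m} {n} (graph m L) e ≡ graph n L e
embed-graph {m} {n} {L} w e@(i , j , p) with toℕ i <? m | toℕ j <? m
... | yes a | no b = sym (∉⇒graph e λ q → b (proj₂ (All.lookup w q)))
... | no a | _ = sym (∉⇒graph e λ q → a (<-trans p (proj₂ (All.lookup w q))))
... | yes a | yes b with Fin.<-cmp (fromℕ< a) (fromℕ< b)
...   | tri< _ _ _ = cong₂ (λ x y → does ((x , y) ∈? L)) (Fin.toℕ-fromℕ< a) (Fin.toℕ-fromℕ< b)
...   | tri≈ ¬q _ _ = contradiction (subst₂ _<_ (sym (Fin.toℕ-fromℕ< a)) (sym (Fin.toℕ-fromℕ< b)) p) ¬q
...   | tri> ¬q _ _ = contradiction (subst₂ _<_ (sym (Fin.toℕ-fromℕ< a)) (sym (Fin.toℕ-fromℕ< b)) p) ¬q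

-- Relabelling vertices

mapE : (ℕ → ℕ) → E → E
mapE f (i , j) = ⟪ f i , f j ⟫

⟪⟫-sym : ∀ i j → ⟪ i , j ⟫ ≡ ⟪ j , i ⟫
⟪⟫-sym i j = cong₂ _,_ (⊓-comm i j) (⊔-comm i j)

⟪⟫-< : ∀ {i j} → i < j → ⟪ i , j ⟫ ≡ (i , j)
⟪⟫-< p = cong₂ _,_ (m≤n⇒m⊓n≡m (<⇒≤ p)) (m≤n⇒m⊔n≡n (<⇒≤ p))

⟪⟫-> : ∀ {i j} → j < i → ⟪ i , j ⟫ ≡ (j , i)
⟪⟫-> p = trans (⟪⟫-sym _ _) (⟪⟫-< p)

⟪⟫-within : ∀ {n i j} → i ≢ j → i < n → j < n → Within n ⟪ i , j ⟫
⟪⟫-within {n} {i} {j} i≢j i<n j<n with <-cmp i j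
... | tri< p _ _ = subst (Within n) (sym (⟪⟫-< p)) (p , j<n)
... | tri≈ _ p _ = contradiction p i≢j
... | tri> _ _ p = subst (Within n) (sym (⟪⟫-> p)) (p , i<n)

mapE-⟪⟫ : ∀ f i j → mapE f ⟪ i , j ⟫ ≡ ⟪ f i , f j ⟫
mapE-⟪⟫ f i j with <-cmp i j
... | tri< p _ _ = cong (mapE f) (⟪⟫-< p)
... | tri≈ _ refl _ = cong₂ (λ x y → ⟪ f x , f y ⟫) (⊓-idem i) (⊔-idem i)
... | tri> _ _ p = trans (cong (mapE f) (⟪⟫-> p)) (⟪⟫-sym _ _)

-- The pair must be ordered because `mapE` only returns ordered pairs.
mapE-inverse : ∀ (f g : ℕ → ℕ) → (∀ x → g (f x) ≡ x) → ∀ {e} → proj₁ e < proj₂ e → mapE g (mapE f e) ≡ e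
mapE-inverse f g inv {i , j} p =
  trans (mapE-⟪⟫ g (f i) (f j)) (trans (cong₂ ⟪_,_⟫ (inv i) (inv j)) (⟪⟫-< p))

swap : ℕ → ℕ → ℕ → ℕ
swap a b x with x ≟ a | x ≟ b
... | yes _ | _ = b
... | no _ | yes _ = a
... | no _ | no _ = x

swap-eq₁ : ∀ a b → swap a b a ≡ b
swap-eq₁ a b with a ≟ a
... | yes _ = refl
... | no p = contradiction refl p

swap-eq₂ : ∀ a b → swap a b b ≡ a
swap-eq₂ a b with b ≟ a | b ≟ b
... | yes p | _ = p
... | no _ | yes _ = refl
... | no _ | no p = contradiction refl p

swap-≢ : ∀ {a b x} → x ≢ a → x ≢ b → swap a b x ≡ x
swap-≢ {a} {b} {x} p q with x ≟ a | x ≟ b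
... | yes r | _ = contradiction r p
... | no _ | yes r = contradiction r q
... | no _ | no _ = refl

swap-involutive : ∀ a b x → swap a b (swap a b x) ≡ x
swap-involutive a b x = by-cases (x ≟ a) (x ≟ b)
  where
  by-cases : Dec (x ≡ a) → Dec (x ≡ b) → swap a b (swap a b x) ≡ x
  by-cases (yes refl) _ = trans (cong (swap a b) (swap-eq₁ a b)) (swap-eq₂ a b)
  by-cases (no _) (yes refl) = trans (cong (swap a b) (swap-eq₂ a b)) (swap-eq₁ a b)
  by-cases (no p) (no q) = trans (cong (swap a b) (swap-≢ p q)) (swap-≢ p q)

toℕ-transpose : (i j k : Fin n) → toℕ (transpose i j ⟨$⟩ʳ k) ≡ swap (toℕ i) (toℕ j) (toℕ k)
toℕ-transpose i j k with k Fin.≟ i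
... | yes refl = sym (swap-eq₁ (toℕ k) (toℕ j))
... | no p with k Fin.≟ j
...   | yes refl = sym (swap-eq₂ (toℕ i) (toℕ k))
...   | no q = sym (swap-≢ (p ∘ Fin.toℕ-injective) (q ∘ Fin.toℕ-injective))

hasEdge-graph : ∀ {L} (i j : Fin n) → All (Within n) L →
  hasEdge (graph n L) i j ≡ does (⟪ toℕ i , toℕ j ⟫ ∈? L)
hasEdge-graph {L = L} i j w with Fin.<-cmp i j
... | tri< p _ _ = cong (λ x → does (x ∈? L)) (sym (⟪⟫-< p))
... | tri> _ _ p = cong (λ x → does (x ∈? L)) (sym (⟪⟫-> p))
... | tri≈ _ refl _ = sym (dec-false (⟪ toℕ i , toℕ i ⟫ ∈? L) λ q →
  <-irrefl (trans (⊓-idem (toℕ i)) (sym (⊔-idem (toℕ i)))) (proj₁ (All.lookup w q)))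

∈-mapE-involutive : ∀ {n L f} → (∀ x → f (f x) ≡ x) → All (Within n) L → ∀ {i j} → i < j →
  ⟪ f i , f j ⟫ ∈ L ⇔ (i , j) ∈ map (mapE f) L
∈-mapE-involutive {f = f} inv w p = mk⇔
  (λ q → subst (_∈ _) (mapE-inverse f f inv p) (∈-map⁺ (mapE f) q))
  (λ q → case ∈-map⁻ (mapE f) q of λ { (e , e∈ , eq) →
    subst (_∈ _) (trans (sym (mapE-inverse f f inv (proj₁ (All.lookup w e∈)))) (cong (mapE f) (sym eq))) e∈ })

-- `relabel` pulls a graph back along the permutation while `mapE` pushes edges forward. A
-- transposition is its own inverse, so the two agree.
relabel-graph : ∀ {L} (i j : Fin n) → All (Within n) L → ∀ e →
  relabel (transpose i j) (graph n L) e ≡ graph n (map (mapE (swap (toℕ i) (toℕ j))) L) e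
relabel-graph {L = L} i j w e@(k , l , p) = trans (hasEdge-graph _ _ w)
  (trans (cong₂ (λ x y → does (⟪ x , y ⟫ ∈? L)) (toℕ-transpose i j k) (toℕ-transpose i j l))
    (Bool-ext (λ q → ∈⇒graph e (Equivalence.to iff (true⇒∈ q))) λ q → dec-true (_ ∈? L) (Equivalence.from iff (graph⇒∈ e q))))
  where
  iff = ∈-mapE-involutive {f = swap (toℕ i) (toℕ j)} (swap-involutive (toℕ i) (toℕ j)) w p
  true⇒∈ : ∀ {x} → does (x ∈? L) ≡ true → x ∈ L
  true⇒∈ {x} q with x ∈? L
  ... | yes r = r

mapE-within : ∀ {f} → (∀ {x y} → f x ≡ f y → x ≡ y) → (∀ {x} → x < n → f x < n) → ∀ {L} →
  All (Within n) L → All (Within n) (map (mapE f) L)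
mapE-within inj bd w = All.map⁺ (All.map (λ (p , q) →
  ⟪⟫-within (λ eq → <⇒≢ p (inj eq)) (bd (<-trans p q)) (bd q)) w)

Proper : List E → Set
Proper = All (λ e → proj₁ e < proj₂ e)

mapE-unique : ∀ (f g : ℕ → ℕ) → (∀ x → g (f x) ≡ x) → ∀ {L} → Proper L →
  Unique L → Unique (map (mapE f) L)
mapE-unique f g inv w u = Unique.map⁻ {f = mapE g}
  (subst Unique (sym (trans (sym (map-∘ _)) (map-id-local (All.map (mapE-inverse f g inv) w)))) u)

swap-< : ∀ {a b x} → a < n → b < n → x < n → swap a b x < n
swap-< {a = a} {b} {x} p q r with x ≟ a | x ≟ b
... | yes _ | _ = q
... | no _ | yes _ = p
... | no _ | no _ = r

_On_ : List E → List ℕ → Set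
L On V = All (λ (i , j) → i ∈ V × j ∈ V) L

Avoids : ℕ → List E → Set
Avoids v = All (λ (i , j) → v ≢ i × v ≢ j)

Unique-++⁻ : ∀ (xs : List A) {ys} → Unique (xs ++ ys) →
  Unique xs × Unique ys × (∀ {z} → z ∈ xs → z ∉ ys)
Unique-++⁻ [] u = [] , u , λ ()
Unique-++⁻ (x ∷ xs) (x∉ ∷ u) with u₁ , u₂ , disj ← Unique-++⁻ xs u =
  All.++⁻ˡ xs x∉ ∷ u₁ , u₂ , λ where
    (here refl) q → All.lookup (All.++⁻ʳ xs x∉) q refl
    (there p) q → disj p q

Unique-shuffle : ∀ (X : List A) {e Y} → Unique (X ++ e ∷ Y) → Unique (e ∷ X ++ Y)
Unique-shuffle X u with u₁ , (e∉ ∷ u₂) , disj ← Unique-++⁻ X u =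
  All.++⁺ (All.tabulate λ { p refl → disj p (here refl) }) e∉ ∷ Unique.++⁺ u₁ u₂ (λ (p , q) → disj p (there q))

⊆-shuffle : ∀ (X : List A) {e Y} → e ∷ X ++ Y ⊆ X ++ e ∷ Y
⊆-shuffle X (here refl) = ∈-++⁺ʳ X (here refl)
⊆-shuffle X (there p) = [ ∈-++⁺ˡ , ∈-++⁺ʳ X ∘ there ]′ (∈-++⁻ X p)

On-⊆ : ∀ {L L′ V} → L ⊆ L′ → L′ On V → L On V
On-⊆ sub on = All.tabulate λ p → All.lookup on (sub p)

On-weaken : ∀ {L V V′} → V ⊆ V′ → L On V → L On V′
On-weaken sub = All.map λ (p , q) → sub p , sub q

⟪⟫-ends : ∀ {p} {P : ℕ → Set p} {i j} → P i → P j → P (proj₁ ⟪ i , j ⟫) × P (proj₂ ⟪ i , j ⟫)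
⟪⟫-ends {P = P} {i} {j} p q with <-cmp i j
... | tri< lt _ _ = subst (λ (x , y) → P x × P y) (sym (⟪⟫-< lt)) (p , q)
... | tri≈ _ refl _ = subst P (sym (⊓-idem i)) p , subst P (sym (⊔-idem i)) p
... | tri> _ _ gt = subst (λ (x , y) → P x × P y) (sym (⟪⟫-> gt)) (q , p)

-- The entries of `⟪ v , a ⟫` add up to `v + a` in either order, and `v` cancels.
⟪⟫-injectiveʳ : ∀ {v a b} → ⟪ v , a ⟫ ≡ ⟪ v , b ⟫ → a ≡ b
⟪⟫-injectiveʳ {v} {a} {b} eq = +-cancelˡ-≡ v a b (trans (sym (total a)) (trans (cong (λ (x , y) → x + y) eq) (total b)))
  where
  total : ∀ x → v ⊓ x + (v ⊔ x) ≡ v + x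
  total x with <-cmp v x
  ... | tri< lt _ _ = cong (λ (i , j) → i + j) (⟪⟫-< lt)
  ... | tri≈ _ refl _ = cong₂ _+_ (⊓-idem v) (⊔-idem v)
  ... | tri> _ _ gt = trans (cong (λ (i , j) → i + j) (⟪⟫-> gt)) (+-comm x v)

On-mapE : ∀ {f L V W} → (∀ {x} → x ∈ V → f x ∈ W) → L On V → map (mapE f) L On W
On-mapE {W = W} h on = All.map⁺ (All.map (λ (p , q) → ⟪⟫-ends {P = _∈ W} (h p) (h q)) on)

K33-edges : List E
K33-edges = (0 , 3) ∷ (0 , 4) ∷ (0 , 5) ∷ (1 , 3) ∷ (1 , 4) ∷ (1 , 5) ∷ (2 , 3) ∷ (2 , 4) ∷ (2 , 5) ∷ []

-- Independence of edge lists

module Independence (F : RigidityFamily2) where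

  -- Some level large enough for `L` is stored; by `indep-at` the choice is immaterial, so vertices
  -- can be added without tracking the ground set.
  record Ind (L : List E) : Set where
    constructor ind
    field
      level : ℕ
      unique : Unique L
      within : All (Within (2 + level)) L
      indep : Indep (M F level) (graph (2 + level) L)

  open Ind

  Within-mono : ∀ {m n} → m ≤ n → ∀ {L} → All (Within (2 + m)) L → All (Within (2 + n)) L
  Within-mono m≤n = All.map λ (p , q) → p , <-≤-trans q (s≤s (s≤s m≤n))

  proper : ∀ {L} → Ind L → Proper L
  proper I = All.map proj₁ (within I)

  -- Neither level need be the larger, so both graphs are embedded at the sum of the levels, where
  -- they have the same edge list.
  indep-at : ∀ {L} → Ind L → ∀ l → All (Within (2 + l)) L → Indep (M F l) (graph (2 + l) L)
  indep-at I l w = Equivalence.from (matroidal F l m (m≤n+m l (level I)) _)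
    (Indep-resp (M F m) (λ e → trans (embed-graph (within I) e) (sym (embed-graph w e)))
      (Equivalence.to (matroidal F (level I) m (m≤m+n (level I) l) _) (indep I)))
    where m = level I + l

  Ind-⊆ : ∀ {A B} → Unique A → A ⊆ B → Ind B → Ind A
  Ind-⊆ u sub (ind l _ w i) = ind l u (All.tabulate λ p → All.lookup w (sub p))
    (Indep-⊆ (M F l) (λ e p → ∈⇒graph e (sub (graph⇒∈ e p))) i)

  Ind-edgesOf : ∀ k (G : Graph (2 + k)) → Indep (M F k) G → Ind (edgesOf G)
  Ind-edgesOf k G i = ind k (edgesOf-unique G) (edgesOf-within G) (Indep-resp (M F k) (graph-edgesOf G) i)

  Ind-[] : Ind []
  Ind-[] = ind 0 [] [] (Indep-resp (M F 0) (λ e → sym (∉⇒graph {L = []} e λ ())) (Indep-∅ (M F 0)))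

  augment : ∀ {A B} → Ind A → Ind B → length A < length B → Σ[ e ∈ E ] e ∈ B × e ∉ A × Ind (e ∷ A)
  augment {A} {B} I J lt
    with wA ← Within-mono (m≤m+n (level I) (level J)) (within I)
    with wB ← Within-mono (m≤n+m (level J) (level I)) (within J)
    with f , f∈B , f∉A , iC ← Indep-aug (M F (level I + level J)) (indep-at I _ wA) (indep-at J _ wB)
           (subst₂ _<_ (sym (card-graph (unique I) wA)) (sym (card-graph (unique J) wB)) lt)
    = toE f , graph⇒∈ f f∈B , f∉ , ind (level I + level J) (All.tabulate (λ { p refl → f∉ p }) ∷ unique I) (toE-within f ∷ wA)
        (iC _ λ x → mk⇔ (λ p → to x (graph⇒∈ x p)) λ p → ∈⇒graph x (from x p))
    where
    f∉ = graph⇒∉ f f∉A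
    to : ∀ x → toE x ∈ toE f ∷ A → graph _ A x ≡ true ⊎ x ≡ f
    to x (here eq) = inj₂ (toE-injective eq)
    to x (there p) = inj₁ (∈⇒graph x p)
    from : ∀ x → graph _ A x ≡ true ⊎ x ≡ f → toE x ∈ toE f ∷ A
    from x (inj₁ p) = there (graph⇒∈ x p)
    from x (inj₂ refl) = here refl

  Ind-swap : ∀ a b {L} → Ind L → Ind (map (mapE (swap a b)) L)
  Ind-swap a b {L} I = ind l
    (mapE-unique (swap a b) (swap a b) (swap-involutive a b) (proper I) (unique I))
    (mapE-within (λ {x} {y} eq → trans (sym (swap-involutive a b x)) (trans (cong (swap a b) eq) (swap-involutive a b y)))
      (swap-< a<n b<n) w)
    (Indep-resp (M F l)
      (λ e → trans (relabel-graph i j w e) (cong₂ (λ x y → graph N (map (mapE (swap x y)) L) e) (Fin.toℕ-fromℕ< a<n) (Fin.toℕ-fromℕ< b<n)))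
      (Equivalence.to (symmetric F l (transpose i j) _) (indep-at I l w)))
    where
    -- The level is raised so that `a` and `b` are vertices too, even when no edge of `L` meets
    -- them.
    l = a + b + level I
    N = 2 + l
    a<n : a < N
    a<n = s≤s (m≤n⇒m≤1+n (≤-trans (m≤m+n a b) (m≤m+n (a + b) (level I))))
    b<n : b < N
    b<n = s≤s (m≤n⇒m≤1+n (≤-trans (m≤n+m b a) (m≤m+n (a + b) (level I))))
    i = fromℕ< a<n
    j = fromℕ< b<n
    w = Within-mono (m≤n+m (level I) (a + b)) (within I)

  -- A permutation of all naturals under which independence is invariant in both directions. Every
  -- one constructed below is a product of transpositions, so only `Ind-swap` appeals to the
  -- symmetry axiom.
  record Symmetry : Set where
    field
      to from : ℕ → ℕ
      from∘to : ∀ x → from (to x) ≡ x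
      to∘from : ∀ x → to (from x) ≡ x
      Ind-to : ∀ {L} → Ind L → Ind (map (mapE to) L)
      Ind-from : ∀ {L} → Ind L → Ind (map (mapE from) L)

  open Symmetry

  identity : Symmetry
  identity = record { to = id ; from = id ; from∘to = λ _ → refl ; to∘from = λ _ → refl ; Ind-to = fixed ; Ind-from = fixed }
    where
    fixed : ∀ {L} → Ind L → Ind (map (mapE id) L)
    fixed I = subst Ind (sym (map-id-local (All.map ⟪⟫-< (proper I)))) I

  _thenSwap_and_ : Symmetry → ℕ → ℕ → Symmetry
  π thenSwap a and b = record
    { to = swap a b ∘ to π
    ; from = from π ∘ swap a b
    ; from∘to = λ x → trans (cong (from π) (swap-involutive a b _)) (from∘to π x)
    ; to∘from = λ x → trans (cong (swap a b) (to∘from π _)) (swap-involutive a b x)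
    ; Ind-to = λ {L} I → subst Ind (fuse (swap a b) (to π) L) (Ind-swap a b (Ind-to π I))
    ; Ind-from = λ {L} I → subst Ind (fuse (from π) (swap a b) L) (Ind-from π (Ind-swap a b I)) }
    where
    fuse : ∀ f g L → map (mapE f) (map (mapE g) L) ≡ map (mapE (f ∘ g)) L
    fuse f g L = trans (sym (map-∘ L)) (map-cong (λ (i , j) → mapE-⟪⟫ f (g i) (g j)) L)

  -- Since `downFrom (suc n)` is `n ∷ downFrom n`, the induction only has to send one further index
  -- to `x`. Composing with the transposition of `x` and the present image `y` of that index does
  -- so. It leaves the entries of `V` fixed: `y` is the image of an index outside
  -- `downFrom (length V)`, and `x` does not repeat.
  symmetryOnto : ∀ {V} → Unique V → Σ[ π ∈ Symmetry ] map (to π) (downFrom (length V)) ≡ V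
  symmetryOnto {[]} [] = identity , refl
  symmetryOnto {x ∷ V} (x∉ ∷ u) with π , eq ← symmetryOnto u =
    π thenSwap y and x , cong₂ _∷_ (swap-eq₁ y x)
      (trans (map-∘ (downFrom (length V))) (trans (cong (map (swap y x)) eq)
        (map-id-local (All.tabulate λ z∈ → swap-≢ (λ { refl → y∉ z∈ }) λ { refl → All.lookup x∉ z∈ refl }))))
    where
    y = to π (length V)
    y∉ : y ∉ V
    y∉ p with i , i∈ , eq′ ← ∈-map⁻ (to π) (subst (y ∈_) (sym eq) p) =
      <-irrefl (trans (sym (from∘to π i)) (trans (cong (from π) (sym eq′)) (from∘to π _))) (∈-downFrom⁻ i∈)

  double-∸ : ∀ k → 2 * (2 + k) ∸ 3 + 3 ≡ 2 * (2 + k)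
  double-∸ k = m∸n+n≡m (≤-trans (s≤s (s≤s (s≤s z≤n))) (*-monoʳ-≤ 2 (s≤s (s≤s (z≤n {k})))))

  -- The inverse of `symmetryOnto` carries `V` to an initial segment, which is the whole vertex set
  -- of the matroid on `length V` vertices; there `rank-bound` applies. Writing `+ 3` on the left
  -- avoids truncated subtraction.
  rank : ∀ {L V} → Unique V → 2 ≤ length V → Ind L → L On V → length L + 3 ≤ 2 * length V
  rank {L} {V@(_ ∷ _ ∷ V′)} u (s≤s (s≤s z≤n)) I on with π , eq ← symmetryOnto u = begin
    length L + 3                         ≡⟨ cong (_+ 3) (trans (sym (length-map (mapE (from π)) L)) (sym (card-graph (unique I′) w))) ⟩
    card (graph N L′) + 3                ≤⟨ +-monoˡ-≤ 3 (rank-bound F k _ (indep-at I′ k w)) ⟩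
    2 * N ∸ 3 + 3                        ≡⟨ double-∸ k ⟩
    2 * length V                         ∎
    where
    open ≤-Reasoning
    k = length V′
    N = 2 + k
    L′ = map (mapE (from π)) L
    I′ = Ind-from π I
    low : ∀ {x} → x ∈ V → from π x < N
    low {x} p with i , i∈ , refl ← ∈-map⁻ (to π) (subst (x ∈_) (sym eq) p) =
      subst (_< N) (sym (from∘to π i)) (∈-downFrom⁻ i∈)
    w : All (Within N) L′
    w = All.map⁺ (All.tabulate λ {e} p → let q , r = All.lookup on p in
      ⟪⟫-within (λ eq′ → <-irrefl (trans (sym (to∘from π _)) (trans (cong (to π) eq′) (to∘from π _))) (All.lookup (proper I) p))
        (low q) (low r))

  basis : ∀ {V} → Unique V → 2 ≤ length V → Σ[ L ∈ List E ] Ind L × L On V × length L + 3 ≡ 2 * length V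
  basis {V@(_ ∷ _ ∷ V′)} u (s≤s (s≤s z≤n))
    with π , eq ← symmetryOnto u | G , i , c ← rank-attained F (length V′) =
      map (mapE (to π)) (edgesOf G) , Ind-to π (Ind-edgesOf _ G i)
      , On-mapE {V = downFrom (length V)} (λ {x} p → subst (to π x ∈_) eq (∈-map⁺ (to π) p))
          (All.map (λ (p , q) → ∈-downFrom⁺ (<-trans p q) , ∈-downFrom⁺ q) (edgesOf-within G))
      , trans (cong (_+ 3) (trans (length-map _ (edgesOf G)) (trans (sym (card≡length G)) c))) (double-∸ (length V′))

  -- The edges are obtained by `d` augmentations; they are collected in front of `A` so that later
  -- arguments can ask where each of them came from.
  extend : ∀ {A B} → Ind A → Ind B → ∀ d → d + length A ≡ length B →
    Σ[ X ∈ List E ] X ⊆ B × length X ≡ d × Ind (X ++ A)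
  extend I J zero eq = [] , (λ ()) , refl , I
  extend {A} {B} I J (suc d) eq =
    let e , e∈ , _ , I′ = augment I J (subst (suc (length A) ≤_) eq (s≤s (m≤n+m _ d)))
        X , X⊆ , len , K = extend I′ J d (trans (+-suc d _) eq)
    in e ∷ X , (λ { (here refl) → e∈ ; (there p) → X⊆ p }) , cong suc len ,
      Ind-⊆ (Unique-shuffle X (unique K)) (⊆-shuffle X) K

-- Extensions

∈⇒≤sum : ∀ {x xs} → x ∈ xs → x ≤ sum xs
∈⇒≤sum {xs = y ∷ xs} (here refl) = m≤m+n y (sum xs)
∈⇒≤sum {xs = y ∷ xs} (there p) = ≤-trans (∈⇒≤sum p) (m≤n+m (sum xs) y)

fresh : ∀ xs → Σ[ x ∈ ℕ ] x ∉ xs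
fresh xs = suc (sum xs) , λ p → <-irrefl refl (∈⇒≤sum p)

⊆-Unique⇒⊇ : ∀ {X Z : List E} → Unique X → X ⊆ Z → length Z ≤ length X → Z ⊆ X
⊆-Unique⇒⊇ {X} {Z} u sub le {z} z∈ with z ∈? X
... | yes p = p
... | no z∉ = contradiction
  (Unique-⊆⇒length≤ (All.tabulate (λ { p refl → z∉ p }) ∷ u) λ { (here refl) → z∈ ; (there p) → sub p })
  (<⇒≱ (s≤s le))

∉⇒Avoids : ∀ {L V v} → v ∉ V → L On V → Avoids v L
∉⇒Avoids v∉ = All.map λ (p , q) → (λ { refl → v∉ p }) , λ { refl → v∉ q }

∉⇒All≢ : ∀ {x : ℕ} {xs ys} → x ∉ ys → xs ⊆ ys → All (x ≢_) xs
∉⇒All≢ x∉ sub = All.tabulate λ { p refl → x∉ (sub p) }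

spoke-avoided : ∀ {v a L} → Avoids v L → ⟪ v , a ⟫ ∉ L
spoke-avoided {v} {a} av p with ⊓-sel v a | All.lookup av p
... | inj₁ eq | v≢ , _ = v≢ (sym eq)
... | inj₂ eq | _ , v≢ = v≢ (sym (m≥n⇒m⊔n≡m (≤-trans (≤-reflexive (sym eq)) (m⊓n≤m v a))))

spokes : ℕ → List ℕ → List E
spokes v = map ⟪ v ,_⟫

spokes-unique : ∀ {v xs L} → Avoids v L → Unique L → Unique xs → Unique (spokes v xs ++ L)
spokes-unique {v} av uL u = Unique.++⁺ (Unique.map⁺ ⟪⟫-injectiveʳ u) uL
  λ (p , q) → case ∈-map⁻ ⟪ v ,_⟫ p of λ { (_ , _ , refl) → spoke-avoided av q }

spokes-On : ∀ {v xs W} → xs ⊆ W → spokes v xs On (v ∷ W)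
spokes-On {W = W} sub = All.map⁺ (All.tabulate λ p → ⟪⟫-ends {P = _∈ _ ∷ W} (here refl) (there (sub p)))

spoke-shape : ∀ {e v V} → proj₁ e < proj₂ e → proj₁ e ∈ v ∷ V → proj₂ e ∈ v ∷ V →
  ¬ (proj₁ e ∈ V × proj₂ e ∈ V) → Σ[ x ∈ ℕ ] x ∈ V × e ≡ ⟪ v , x ⟫
spoke-shape lt (here refl) (here refl) _ = contradiction lt (<-irrefl refl)
spoke-shape lt (here refl) (there q) _ = _ , q , sym (⟪⟫-< lt)
spoke-shape lt (there p) (here refl) _ = _ , p , sym (⟪⟫-> lt)
spoke-shape lt (there p) (there q) not = contradiction (p , q) not

swap-∈ : ∀ {a b x V} → a ∈ V → b ∈ V → x ∈ V → swap a b x ∈ V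
swap-∈ {a} {b} {x} p q r with x ≟ a | x ≟ b
... | yes _ | _ = q
... | no _ | yes _ = p
... | no _ | no _ = r

length≡2 : ∀ {xs : List A} → length xs ≡ 2 → Σ[ x ∈ A ] Σ[ y ∈ A ] xs ≡ x ∷ y ∷ []
length≡2 {xs = x ∷ y ∷ []} refl = x , y , refl

2≤length : ∀ {a b : ℕ} {V} → a ≢ b → a ∈ V → b ∈ V → 2 ≤ length V
2≤length a≢b p q = Unique-⊆⇒length≤ ((a≢b ∷ []) ∷ [] ∷ []) λ { (here refl) → p ; (there (here refl)) → q }

module Extensions (F : RigidityFamily2) where
  open Independence F
  open Ind
  open Symmetry

  Ind-shuffle : ∀ X {e L} → Ind (X ++ e ∷ L) → Ind (e ∷ X ++ L)
  Ind-shuffle X I = Ind-⊆ (Unique-shuffle X (unique I)) (⊆-shuffle X) I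

  Ind-cons : ∀ {X B e} → Ind (X ++ B) → e ∈ X → Ind (e ∷ B)
  Ind-cons {X} {B} {e} J e∈ = Ind-⊆ u sub J
    where
    u : Unique (e ∷ B)
    u = All.tabulate (λ { p refl → proj₂ (proj₂ (Unique-++⁻ X (unique J))) e∈ p }) ∷ proj₁ (proj₂ (Unique-++⁻ X (unique J)))
    sub : e ∷ B ⊆ X ++ B
    sub (here refl) = ∈-++⁺ˡ e∈
    sub (there p) = ∈-++⁺ʳ X p

  -- `V` consists of all numbers below `N` other than `v`, where `N` exceeds the vertices of `L`
  -- and, through their sum, all entries of `xs`.
  ambient : ∀ {L v xs} → Ind L → Avoids v L → v ∉ xs →
    Σ[ V ∈ List ℕ ] Unique V × v ∉ V × L On V × xs ⊆ V
  ambient {L} {v} {xs} I av v∉ = filter V? (upTo N) , Unique.filter⁺ V? (Unique.upTo⁺ N)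
    , (λ p → proj₂ (∈-filter⁻ V? {xs = upTo N} p) refl)
    , All.tabulate (λ p → let lt , j< = All.lookup (within I) p ; v≢i , v≢j = All.lookup av p in
        ∈V (<-≤-trans (<-trans lt j<) (m≤m+n (2 + level I) (sum xs))) (v≢i ∘ sym)
        , ∈V (<-≤-trans j< (m≤m+n (2 + level I) (sum xs))) (v≢j ∘ sym))
    , λ p → ∈V (s≤s (≤-trans (∈⇒≤sum p) (≤-trans (m≤n+m (sum xs) (level I)) (n≤1+n _)))) λ { refl → v∉ p }
    where
    N = 2 + level I + sum xs
    V? : ∀ x → Dec (¬ x ≡ v)
    V? x = ¬? (x ≟ v)
    ∈V : ∀ {x} → x < N → x ≢ v → x ∈ filter V? (upTo N)
    ∈V lt x≢v = ∈-filter⁺ V? (∈-upTo⁺ lt) x≢v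

  extend-to-basis : ∀ {V} → Unique V → 2 ≤ length V → ∀ {L} → Ind L → L On V →
    Σ[ X ∈ List E ] X On V × Ind (X ++ L) × length X + length L + 3 ≡ 2 * length V
  extend-to-basis uV 2≤V {L} I on =
    let Y , J , Yon , lenY = basis uV 2≤V
        d+L≡Y = m∸n+n≡m (+-cancelʳ-≤ 3 (length L) (length Y) (subst (length L + 3 ≤_) (sym lenY) (rank uV 2≤V I on)))
        X , X⊆ , lenX , K = extend I J (length Y ∸ length L) d+L≡Y
    in X , On-⊆ X⊆ Yon , K , trans (cong (_+ 3) (trans (cong (_+ length L) lenX) d+L≡Y)) lenY

  module _ {V : List ℕ} (uV : Unique V) (2≤V : 2 ≤ length V) where

    module _ {B : List E} (I : Ind B) (on : B On V) (full : length B + 3 ≡ 2 * length V) where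

      -- `B` already attains the rank on `V`, so one more edge inside `V` would exceed it.
      spans : ∀ {X e} → Ind (X ++ B) → e ∈ X → ¬ (proj₁ e ∈ V × proj₂ e ∈ V)
      spans J e∈ eon = <-irrefl full (rank uV 2≤V (Ind-cons J e∈) (eon ∷ on))

      -- Two bases on `V` have the same span, so either may stand beside `Z`. Concretely, `B` is
      -- extended by `length Z` edges of `Z ++ Y`. None of them lies in `Y`, because `B` spans `V`;
      -- hence they come from `Z`, and by their number they exhaust it.
      exchange : ∀ Z {Y} → Ind (Z ++ Y) → Y On V → length Y ≡ length B → Ind (Z ++ B)
      exchange Z {Y} J Yon len =
        let X , X⊆ , lenX , K = extend I J (length Z) (trans (cong (length Z +_) (sym len)) (sym (length-++ Z)))
            uX , _ , disj = Unique-++⁻ X (unique K)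
            X⊆Z : X ⊆ Z
            X⊆Z p = [ id , (λ q → contradiction (All.lookup Yon q) (spans K p)) ]′ (∈-++⁻ Z (X⊆ p))
            Z⊆X = ⊆-Unique⇒⊇ uX X⊆Z (≤-reflexive (sym lenX))
        in Ind-⊆ (Unique.++⁺ (proj₁ (Unique-++⁻ Z (unique J))) (unique I) (λ (p , q) → disj (Z⊆X p) q))
             (λ p → [ ∈-++⁺ˡ ∘ Z⊆X , ∈-++⁺ʳ X ]′ (∈-++⁻ Z p)) K

      -- Swapping `x` and `a` fixes `v` and moves the spokes as desired, but it also turns `B` into
      -- another basis on `V`; `exchange` restores `B`.
      redirect : ∀ {v x y a} → v ∉ V → x ∈ V → y ∈ V → a ∈ V →
        Ind (⟪ v , x ⟫ ∷ ⟪ v , y ⟫ ∷ B) → Ind (⟪ v , a ⟫ ∷ ⟪ v , swap x a y ⟫ ∷ B)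
      redirect {v} {x} {y} {a} v∉ x∈ y∈ a∈ J =
        exchange (⟪ v , a ⟫ ∷ ⟪ v , swap x a y ⟫ ∷ [])
          (subst₂ (λ e f → Ind (e ∷ f ∷ map (mapE (swap x a)) B))
            (trans (moved x) (cong ⟪ v ,_⟫ (swap-eq₁ x a))) (moved y) (Ind-swap x a J))
          (On-mapE (swap-∈ x∈ a∈) on) (length-map _ B)
        where
        moved : ∀ z → mapE (swap x a) ⟪ v , z ⟫ ≡ ⟪ v , swap x a z ⟫
        moved z = trans (mapE-⟪⟫ (swap x a) v z)
          (cong ⟪_, swap x a z ⟫ (swap-≢ (λ { refl → v∉ x∈ }) λ { refl → v∉ a∈ }))

      module _ {v : ℕ} (v∉ : v ∉ V) where

        spoke-of : ∀ {X e} → Ind (X ++ B) → X On (v ∷ V) → e ∈ X → Σ[ x ∈ ℕ ] x ∈ V × e ≡ ⟪ v , x ⟫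
        spoke-of J Xon p = spoke-shape (All.lookup (proper J) (∈-++⁺ˡ p))
          (proj₁ (All.lookup Xon p)) (proj₂ (All.lookup Xon p)) (spans J p)

        -- A new vertex raises the rank by two, and neither new edge can lie inside `V`.
        two-spokes : Σ[ x ∈ ℕ ] Σ[ y ∈ ℕ ] x ∈ V × y ∈ V × Ind (⟪ v , x ⟫ ∷ ⟪ v , y ⟫ ∷ B)
        two-spokes = from-extension (extend-to-basis (∉⇒All≢ v∉ id ∷ uV) (m≤n⇒m≤1+n 2≤V) I (On-weaken there on))
          where
          two : ∀ x b n → x + b + 3 ≡ 2 * suc n → b + 3 ≡ 2 * n → x ≡ 2
          two x b n p q = +-cancelʳ-≡ (b + 3) x 2
            (trans (sym (+-assoc x b 3)) (trans p (trans (*-suc 2 n) (cong (2 +_) (sym q)))))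
          from-pair : ∀ {e f} → Ind (e ∷ f ∷ B) → Σ[ x ∈ ℕ ] x ∈ V × e ≡ ⟪ v , x ⟫ → Σ[ y ∈ ℕ ] y ∈ V × f ≡ ⟪ v , y ⟫ →
            Σ[ x ∈ ℕ ] Σ[ y ∈ ℕ ] x ∈ V × y ∈ V × Ind (⟪ v , x ⟫ ∷ ⟪ v , y ⟫ ∷ B)
          from-pair J (x , x∈ , refl) (y , y∈ , refl) = x , y , x∈ , y∈ , J
          from-extension : Σ[ X ∈ List E ] X On (v ∷ V) × Ind (X ++ B) × length X + length B + 3 ≡ 2 * suc (length V) →
            Σ[ x ∈ ℕ ] Σ[ y ∈ ℕ ] x ∈ V × y ∈ V × Ind (⟪ v , x ⟫ ∷ ⟪ v , y ⟫ ∷ B)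
          from-extension (X , Xon , J , len) with e , f , refl ← length≡2 {xs = X} (two (length X) _ _ len full) =
            from-pair J (spoke-of J Xon (here refl)) (spoke-of J Xon (there (here refl)))

        -- One redirection brings the first end to `a`, a second brings the other to `b`. The second
        -- does not disturb `a`: it differs from `b` by hypothesis and from `y` because the two
        -- spokes are distinct.
        attach : ∀ {a b} → a ∈ V → b ∈ V → a ≢ b → Ind (⟪ v , a ⟫ ∷ ⟪ v , b ⟫ ∷ B)
        attach {a} {b} a∈ b∈ a≢b = from-spokes two-spokes
          where
          then : ∀ {y} → y ∈ V → Ind (⟪ v , a ⟫ ∷ ⟪ v , y ⟫ ∷ B) → Ind (⟪ v , a ⟫ ∷ ⟪ v , b ⟫ ∷ B)
          then {y} y∈ K = Ind-shuffle (_ ∷ []) (subst (λ z → Ind (⟪ v , b ⟫ ∷ ⟪ v , z ⟫ ∷ B)) (swap-≢ a≢y a≢b)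
            (redirect v∉ y∈ a∈ b∈ (Ind-shuffle (_ ∷ []) K)))
            where
            a≢y : a ≢ y
            a≢y a≡y = All.lookup (AllPairs.head (unique K)) (here refl) (cong ⟪ v ,_⟫ a≡y)
          from-spokes : Σ[ x ∈ ℕ ] Σ[ y ∈ ℕ ] x ∈ V × y ∈ V × Ind (⟪ v , x ⟫ ∷ ⟪ v , y ⟫ ∷ B) →
            Ind (⟪ v , a ⟫ ∷ ⟪ v , b ⟫ ∷ B)
          from-spokes (x , y , x∈ , y∈ , J) = then (swap-∈ x∈ a∈ y∈) (redirect v∉ x∈ y∈ a∈ J)

  -- `attach` needs a basis on a vertex set avoiding `v`; `L` is completed to one, and the surplus
  -- edges `X` are discarded afterwards.
  0-extension : ∀ {L v a b} → Ind L → Avoids v L → a ≢ b → v ≢ a → v ≢ b →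
    Ind (⟪ v , a ⟫ ∷ ⟪ v , b ⟫ ∷ L)
  0-extension {L} {v} {a} {b} I av a≢b v≢a v≢b =
    in-ambient (ambient I av λ { (here p) → v≢a p ; (there (here p)) → v≢b p })
    where
    restrict : ∀ X → Ind (⟪ v , a ⟫ ∷ ⟪ v , b ⟫ ∷ X ++ L) → Ind (⟪ v , a ⟫ ∷ ⟪ v , b ⟫ ∷ L)
    restrict X = Ind-⊆ (spokes-unique {xs = a ∷ b ∷ []} av (unique I) ((a≢b ∷ []) ∷ [] ∷ []))
      λ { (here refl) → here refl ; (there (here refl)) → there (here refl) ; (there (there p)) → there (there (∈-++⁺ʳ X p)) }
    in-ambient : Σ[ V ∈ List ℕ ] Unique V × v ∉ V × L On V × (a ∷ b ∷ []) ⊆ V → Ind (⟪ v , a ⟫ ∷ ⟪ v , b ⟫ ∷ L)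
    in-ambient (V , uV , v∉ , on , ab⊆) = in-basis (extend-to-basis uV 2≤V I on)
      where
      2≤V = 2≤length a≢b (ab⊆ (here refl)) (ab⊆ (there (here refl)))
      in-basis : Σ[ X ∈ List E ] X On V × Ind (X ++ L) × length X + length L + 3 ≡ 2 * length V →
        Ind (⟪ v , a ⟫ ∷ ⟪ v , b ⟫ ∷ L)
      in-basis (X , Xon , J , len) = restrict X (attach uV 2≤V J (All.++⁺ Xon on) (trans (cong (_+ 3) (length-++ X)) len)
        v∉ (ab⊆ (here refl)) (ab⊆ (there (here refl))) a≢b)

  0-extension-On : ∀ {W L v a b} → v ∉ W → a ∈ W → b ∈ W → a ≢ b → Ind L → L On W → Ind (⟪ v , a ⟫ ∷ ⟪ v , b ⟫ ∷ L)
  0-extension-On v∉ a∈ b∈ a≢b I on = 0-extension I (∉⇒Avoids v∉ on) a≢b (λ { refl → v∉ a∈ }) (λ { refl → v∉ b∈ })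

-- 1-extensions from an independent K₃,₃

-- The vertices are listed in the order of `downFrom 6`, so that relabelling `K33-edges` by a
-- symmetry from `symmetryOnto` gives this list by computation.
bipartite : List ℕ → List E
bipartite (w ∷ u ∷ v ∷ c ∷ b ∷ a ∷ []) =
  ⟪ a , v ⟫ ∷ ⟪ a , u ⟫ ∷ ⟪ a , w ⟫ ∷ ⟪ b , v ⟫ ∷ ⟪ b , u ⟫ ∷ ⟪ b , w ⟫ ∷ ⟪ c , v ⟫ ∷ ⟪ c , u ⟫ ∷ ⟪ c , w ⟫ ∷ []
bipartite _ = []

module OneExtension (F : RigidityFamily2) where
  open Independence F
  open Ind
  open Symmetry
  open Extensions F

  -- The transposition of `x` and `v` fixes every vertex of `V`, hence `L` and the far ends of the
  -- spokes.
  move-apex : ∀ {V x v xs L} → x ∉ V → v ∉ V → xs ⊆ V → L On V → Ind (spokes x xs ++ L) → Ind (spokes v xs ++ L)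
  move-apex {V} {x} {v} {xs} {L} x∉ v∉ xs⊆ on I = subst Ind
    (trans (map-++ (mapE (swap x v)) (spokes x xs) L)
      (cong₂ _++_
        (trans (sym (map-∘ xs)) (map-cong-local (All.tabulate λ {z} p → trans (mapE-⟪⟫ (swap x v) x z) (cong₂ ⟪_,_⟫ (swap-eq₁ x v) (fixed (xs⊆ p))))))
        (map-id-local (All.tabulate λ p → trans (cong₂ ⟪_,_⟫ (fixed (proj₁ (All.lookup on p))) (fixed (proj₂ (All.lookup on p))))
          (⟪⟫-< (All.lookup (proper I) (∈-++⁺ʳ (spokes x xs) p)))))))
    (Ind-swap x v I)
    where
    fixed : ∀ {z} → z ∈ V → swap x v z ≡ z
    fixed p = swap-≢ (λ { refl → x∉ p }) λ { refl → v∉ p }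

  module _ (K : Ind K33-edges) where

    Ind-bipartite : ∀ {w u v c b a} → Unique (w ∷ u ∷ v ∷ c ∷ b ∷ a ∷ []) → Ind (bipartite (w ∷ u ∷ v ∷ c ∷ b ∷ a ∷ []))
    Ind-bipartite un = subst (Ind ∘ bipartite) (proj₂ (symmetryOnto un)) (Ind-to (proj₁ (symmetryOnto un)) K)

    module _ {V : List ℕ} {B : List E} {a b c v u w : ℕ} (uV : Unique V) (v∉ : v ∉ V) (u∉ : u ∉ v ∷ V) (w∉ : w ∉ u ∷ v ∷ V)
      (a∈ : a ∈ V) (b∈ : b ∈ V) (c∈ : c ∈ V) (a≢b : a ≢ b) (a≢c : a ≢ c) (b≢c : b ≢ c)
      (J : Ind (⟪ a , b ⟫ ∷ B)) (on : (⟪ a , b ⟫ ∷ B) On V) (full : suc (length B) + 3 ≡ 2 * length V) where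

      ab : E
      ab = ⟪ a , b ⟫

      ends : List ℕ
      ends = a ∷ b ∷ []

      ends⊆ : ends ⊆ V
      ends⊆ (here refl) = a∈
      ends⊆ (there (here refl)) = b∈

      frame : List E
      frame = spokes w ends ++ spokes u ends ++ spokes v ends

      -- Used twice: with `ab ∷ B` it gives a basis on all the vertices, with `B` a set one edge
      -- short of it.
      Ind-frame : ∀ {D} → Ind D → D On V → Ind (frame ++ D)
      Ind-frame I Don = 0-extension-On w∉ (there (there a∈)) (there (there b∈)) a≢b
        (0-extension-On u∉ (there a∈) (there b∈) a≢b (0-extension-On v∉ a∈ b∈ a≢b I Don) on₁) on₂
        where
        on₁ = All.++⁺ (spokes-On ends⊆) (On-weaken there Don)
        on₂ = All.++⁺ (spokes-On (there ∘ ends⊆)) (On-weaken there on₁)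

      six : List ℕ
      six = w ∷ u ∷ v ∷ c ∷ b ∷ a ∷ []

      six-unique : Unique six
      six-unique = ∉⇒All≢ w∉ (λ { (here p) → here p ; (there (here p)) → there (here p) ; (there (there p)) → there (there (abc⊆ p)) })
        ∷ ∉⇒All≢ u∉ (λ { (here p) → here p ; (there p) → there (abc⊆ p) })
        ∷ ∉⇒All≢ v∉ abc⊆ ∷ (b≢c ∘ sym ∷ a≢c ∘ sym ∷ []) ∷ (a≢b ∘ sym ∷ []) ∷ [] ∷ []
        where
        abc⊆ : c ∷ b ∷ a ∷ [] ⊆ V
        abc⊆ (here refl) = c∈
        abc⊆ (there (here refl)) = b∈
        abc⊆ (there (there (here refl))) = a∈

      bipartite-On : bipartite six On six
      bipartite-On = edge 5 2 ∷ edge 5 1 ∷ edge 5 0 ∷ edge 4 2 ∷ edge 4 1 ∷ edge 4 0 ∷ edge 3 2 ∷ edge 3 1 ∷ edge 3 0 ∷ []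
        where
        edge : ∀ i j {i< : True (i <? 6)} {j< : True (j <? 6)} →
          let e = ⟪ lookup six (fromℕ< (toWitness i<)) , lookup six (fromℕ< (toWitness j<)) ⟫ in proj₁ e ∈ six × proj₂ e ∈ six
        edge i j {i<} {j<} = ⟪⟫-ends {P = _∈ six} (∈-lookup (fromℕ< (toWitness i<))) (∈-lookup (fromℕ< (toWitness j<)))

      bipartite-spans : ∀ {X} → Ind (X ++ bipartite six) → ab ∉ X
      -- Nine edges are the full rank on six vertices; a tenth would give 10 + 3 ≤ 12.
      bipartite-spans I p = <⇒≱ (n<1+n 12) (rank six-unique (s≤s (s≤s z≤n)) (Ind-cons I p)
        (⟪⟫-ends {P = _∈ six} (there (there (there (there (there (here refl)))))) (there (there (there (there (here refl))))) ∷ bipartite-On))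

      onB : B On V
      onB = All.tail on

      IndB : Ind B
      IndB = Ind-⊆ (AllPairs.tail (unique J)) there J

      -- The apex `x` is existential because augmentation does not reveal which of `u`, `v`, `w`
      -- becomes joined to `c`.
      Apex : Set
      Apex = Σ[ x ∈ ℕ ] x ∉ V × Ind (spokes x (a ∷ b ∷ c ∷ []) ++ B)

      apex : ∀ {x} → x ∉ V → ⟪ x , a ⟫ ∈ frame → ⟪ x , b ⟫ ∈ frame → Ind (⟪ c , x ⟫ ∷ frame ++ B) → Apex
      apex {x} x∉ p q I = x , x∉ , Ind-⊆
        (spokes-unique (∉⇒Avoids x∉ onB) (unique IndB) ((a≢b ∷ a≢c ∷ []) ∷ (b≢c ∷ []) ∷ [] ∷ []))
        (λ { (here refl) → there (∈-++⁺ˡ p) ; (there (here refl)) → there (∈-++⁺ˡ q)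
           ; (there (there (here refl))) → here (⟪⟫-sym x c) ; (there (there (there r))) → there (∈-++⁺ʳ frame r) }) I

      -- An edge of `X` outside `frame ++ B` could only be `ab`, which the K₃,₃ spans. Of the nine
      -- edges of the K₃,₃, the six at `a` or `b` already lie in the frame, so only the three at `c`
      -- remain.
      exchanged-edge : ∀ {X e} → X ⊆ frame ++ ab ∷ B → Ind (X ++ bipartite six) →
        e ∈ X ++ bipartite six → e ∉ frame ++ B → Ind (e ∷ frame ++ B) → Apex
      exchanged-edge {X} {e} X⊆ I e∈ e∉ J′ = [ from-X , from-bipartite ]′ (∈-++⁻ X e∈)
        where
        from-X : e ∈ X → Apex
        from-X p = case ∈-++⁻ frame (X⊆ p) of λ where
          (inj₁ q) → contradiction (∈-++⁺ˡ q) e∉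
          (inj₂ (here refl)) → contradiction p (bipartite-spans I)
          (inj₂ (there q)) → contradiction (∈-++⁺ʳ frame q) e∉
        in-frame : ∀ x y → ⟪ y , x ⟫ ∈ frame → e ≡ ⟪ x , y ⟫ → Apex
        in-frame x y p refl = contradiction (∈-++⁺ˡ (subst (_∈ frame) (⟪⟫-sym y x) p)) e∉
        wa : ⟪ w , a ⟫ ∈ frame
        wa = here refl
        wb : ⟪ w , b ⟫ ∈ frame
        wb = there (here refl)
        ua : ⟪ u , a ⟫ ∈ frame
        ua = there (there (here refl))
        ub : ⟪ u , b ⟫ ∈ frame
        ub = there (there (there (here refl)))
        va : ⟪ v , a ⟫ ∈ frame
        va = there (there (there (there (here refl))))
        vb : ⟪ v , b ⟫ ∈ frame
        vb = there (there (there (there (there (here refl)))))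
        from-bipartite : e ∈ bipartite six → Apex
        from-bipartite (here p) = in-frame a v va p
        from-bipartite (there (here p)) = in-frame a u ua p
        from-bipartite (there (there (here p))) = in-frame a w wa p
        from-bipartite (there (there (there (here p)))) = in-frame b v vb p
        from-bipartite (there (there (there (there (here p))))) = in-frame b u ub p
        from-bipartite (there (there (there (there (there (here p)))))) = in-frame b w wb p
        from-bipartite (there (there (there (there (there (there (here refl))))))) = apex v∉ va vb J′
        from-bipartite (there (there (there (there (there (there (there (here refl)))))))) = apex (u∉ ∘ there) ua ub J′
        from-bipartite (there (there (there (there (there (there (there (there (here refl))))))))) = apex (w∉ ∘ there ∘ there) wa wb J′

      full-apex : Apex
      full-apex = after-extension (extend (Ind-bipartite six-unique) (Ind-frame J on) (length B ∸ 2) count)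
        where
        -- The three distinct vertices `a`, `b`, `c` give 6 ≤ 2|V| = |B| + 4. So the subtraction of
        -- 2 is exact, and `X` together with the nine edges is as large as `frame ++ ab ∷ B`.
        2≤B : 2 ≤ length B
        2≤B = +-cancelʳ-≤ 4 2 (length B) (≤-trans
          (*-monoʳ-≤ 2 (Unique-⊆⇒length≤ {xs = a ∷ b ∷ c ∷ []} ((a≢b ∷ a≢c ∷ []) ∷ (b≢c ∷ []) ∷ [] ∷ [])
            λ { (here refl) → a∈ ; (there (here refl)) → b∈ ; (there (there (here refl))) → c∈ }))
          (≤-reflexive (trans (sym full) (sym (+-suc (length B) 3)))))
        count : length B ∸ 2 + 9 ≡ 7 + length B
        count = trans (sym (+-assoc (length B ∸ 2) 2 7)) (trans (cong (_+ 7) (m∸n+n≡m 2≤B)) (+-comm (length B) 7))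
        after-extension : Σ[ X ∈ List E ] X ⊆ frame ++ ab ∷ B × length X ≡ length B ∸ 2 × Ind (X ++ bipartite six) → Apex
        after-extension (X , X⊆ , lenX , I) = after-augmentation (augment (Ind-frame IndB onB) I
          (≤-reflexive (sym (trans (length-++ X) (trans (cong (_+ 9) lenX) count)))))
          where
          after-augmentation : Σ[ e ∈ E ] e ∈ X ++ bipartite six × e ∉ frame ++ B × Ind (e ∷ frame ++ B) → Apex
          after-augmentation (e , e∈ , e∉ , J′) = exchanged-edge X⊆ I e∈ e∉ J′

    1-extension : ∀ {L v a b c} → Ind (⟪ a , b ⟫ ∷ L) → Avoids v L → v ∉ a ∷ b ∷ c ∷ [] → a ≢ b → a ≢ c → b ≢ c →
      Ind (spokes v (a ∷ b ∷ c ∷ []) ++ L)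
    1-extension {L} {v} {a} {b} {c} I av v∉abc a≢b a≢c b≢c =
      in-ambient (ambient I (⟪⟫-avoided ∷ av) v∉abc)
      where
      ⟪⟫-avoided : v ≢ proj₁ ⟪ a , b ⟫ × v ≢ proj₂ ⟪ a , b ⟫
      ⟪⟫-avoided = ⟪⟫-ends {P = v ≢_} (λ { refl → v∉abc (here refl) }) (λ { refl → v∉abc (there (here refl)) })
      in-ambient : Σ[ V ∈ List ℕ ] Unique V × v ∉ V × (⟪ a , b ⟫ ∷ L) On V × (a ∷ b ∷ c ∷ []) ⊆ V →
        Ind (spokes v (a ∷ b ∷ c ∷ []) ++ L)
      in-ambient (V , uV , v∉ , on , abc⊆) = in-basis (extend-to-basis uV (2≤length a≢b (abc⊆ (here refl)) (abc⊆ (there (here refl)))) I on)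
        where
        in-basis : Σ[ X ∈ List E ] X On V × Ind (X ++ ⟪ a , b ⟫ ∷ L) × length X + suc (length L) + 3 ≡ 2 * length V →
          Ind (spokes v (a ∷ b ∷ c ∷ []) ++ L)
        -- The auxiliary vertices `u` and `w` are fresh. The apex obtained may be any of the three,
        -- so the surplus `X` is dropped and the apex is moved back to `v`.
        in-basis (X , Xon , J , len) = restrict (full-apex uV v∉ (proj₂ (fresh (v ∷ V))) (proj₂ (fresh (_ ∷ v ∷ V)))
          (abc⊆ (here refl)) (abc⊆ (there (here refl))) (abc⊆ (there (there (here refl)))) a≢b a≢c b≢c
          (Ind-shuffle X J) (All.head on ∷ All.++⁺ Xon (All.tail on))
          (trans (cong (_+ 3) (trans (cong suc (length-++ X)) (sym (+-suc (length X) (length L))))) len))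
          where
          restrict : Σ[ x ∈ ℕ ] x ∉ V × Ind (spokes x (a ∷ b ∷ c ∷ []) ++ X ++ L) → Ind (spokes v (a ∷ b ∷ c ∷ []) ++ L)
          restrict (x , x∉ , I′) = move-apex x∉ v∉ abc⊆ (All.tail on) (Ind-⊆
            (spokes-unique (∉⇒Avoids x∉ (All.tail on)) (AllPairs.tail (unique I)) ((a≢b ∷ a≢c ∷ []) ∷ (b≢c ∷ []) ∷ [] ∷ []))
            (λ p → [ ∈-++⁺ˡ , ∈-++⁺ʳ (spokes x (a ∷ b ∷ c ∷ [])) ∘ ∈-++⁺ʳ X ]′ (∈-++⁻ (spokes x (a ∷ b ∷ c ∷ [])) p)) I′)

-- Sparsity and tight sets

bit : Bool → ℕ
bit b = if b then 1 else 0

bit-∨ : ∀ s t → bit (s ∨ t) ≤ bit s + bit t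
bit-∨ true t = s≤s z≤n
bit-∨ false t = ≤-refl

total : (A → ℕ) → List A → ℕ
total f xs = sum (map f xs)

total-+ : ∀ (f g : A → ℕ) xs → total (λ x → f x + g x) xs ≡ total f xs + total g xs
total-+ f g [] = refl
total-+ f g (x ∷ xs) = trans (cong (f x + g x +_) (total-+ f g xs)) (interchange (f x) (g x) (total f xs) (total g xs))
  where
  interchange : ∀ a b c d → a + b + (c + d) ≡ a + c + (b + d)
  interchange = solve-∀

total-mono : ∀ (f g : A → ℕ) xs → (∀ {x} → x ∈ xs → f x ≤ g x) → total f xs ≤ total g xs
total-mono f g [] h = z≤n
total-mono f g (x ∷ xs) h = +-mono-≤ (h (here refl)) (total-mono f g xs (h ∘ there))

total-cong : ∀ (f g : A → ℕ) xs → (∀ {x} → x ∈ xs → f x ≡ g x) → total f xs ≡ total g xs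
total-cong f g xs h = ≤-antisym (total-mono f g xs (≤-reflexive ∘ h)) (total-mono g f xs (≤-reflexive ∘ sym ∘ h))

total-const : ∀ k (xs : List A) → total (λ _ → k) xs ≡ length xs * k
total-const k [] = refl
total-const k (x ∷ xs) = cong (k +_) (total-const k xs)

δ : ℕ → ℕ → ℕ
δ a x = bit (does (x ≟ a))

δ-same : ∀ a → δ a a ≡ 1
δ-same a = cong bit (dec-true (a ≟ a) refl)

δ-diff : ∀ {a x} → x ≢ a → δ a x ≡ 0
δ-diff {a} {x} p = cong bit (dec-false (x ≟ a) p)

1≤total-δ : ∀ {a V} → a ∈ V → 1 ≤ total (δ a) V
1≤total-δ {a} (here refl) = ≤-trans (≤-reflexive (sym (δ-same a))) (m≤m+n (δ a a) _)
1≤total-δ {a} {x ∷ _} (there p) = ≤-trans (1≤total-δ p) (m≤n+m _ (δ a x))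

total-δ≡0 : ∀ {a V} → a ∉ V → total (δ a) V ≡ 0
total-δ≡0 {V = []} a∉ = refl
total-δ≡0 {a} {x ∷ V} a∉ = cong₂ _+_ (δ-diff {a} {x} λ { refl → a∉ (here refl) }) (total-δ≡0 (a∉ ∘ there))

total-δ≤1 : ∀ {a V} → Unique V → total (δ a) V ≤ 1
total-δ≤1 [] = z≤n
total-δ≤1 {a} {x ∷ V} u@(_ ∷ u′) with x ≟ a
... | yes refl = ≤-reflexive (cong₂ _+_ (δ-same a) (total-δ≡0 (Unique.Unique[x∷xs]⇒x∉xs u)))
... | no p = subst (λ d → d + total (δ a) V ≤ 1) (sym (δ-diff p)) (total-δ≤1 u′)

covers : (ℕ → Bool) → E → Bool
covers S (i , j) = S i ∧ S j

covers-⟪⟫ : ∀ S a b → covers S ⟪ a , b ⟫ ≡ S a ∧ S b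
covers-⟪⟫ S a b with <-cmp a b
... | tri< lt _ _ = cong (covers S) (⟪⟫-< lt)
... | tri≈ _ refl _ = cong₂ (λ x y → S x ∧ S y) (⊓-idem a) (⊔-idem a)
... | tri> _ _ gt = trans (cong (covers S) (⟪⟫-> gt)) (Bool.∧-comm (S b) (S a))

size : List ℕ → (ℕ → Bool) → ℕ
size V S = total (bit ∘ S) V

inside : List E → (ℕ → Bool) → ℕ
inside L S = total (bit ∘ covers S) L

Sparse : List ℕ → List E → Set
Sparse V L = ∀ S → 2 ≤ size V S → inside L S + 3 ≤ 2 * size V S

-- Only the inequality opposite to that of `Sparse`; under sparsity it is an equality as soon as `S`
-- has two vertices in `V`.
Tight : List ℕ → List E → (ℕ → Bool) → Set
Tight V L S = 2 * size V S ≤ inside L S + 3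

∧-true : ∀ {x y} → x ∧ y ≡ true → x ≡ true × y ≡ true
∧-true {true} {true} _ = refl , refl

_∪_ _∩_ : (ℕ → Bool) → (ℕ → Bool) → ℕ → Bool
(S ∪ T) x = S x ∨ T x
(S ∩ T) x = S x ∧ T x

size-modular : ∀ V S T → size V S + size V T ≡ size V (S ∪ T) + size V (S ∩ T)
size-modular V S T = trans (sym (total-+ _ _ V)) (trans (total-cong _ _ V λ {x} _ → pointwise (S x) (T x)) (total-+ _ _ V))
  where
  pointwise : ∀ s t → bit s + bit t ≡ bit (s ∨ t) + bit (s ∧ t)
  pointwise true true = refl
  pointwise true false = refl
  pointwise false t = +-comm 0 (bit t)

inside-supermodular : ∀ L S T → inside L S + inside L T ≤ inside L (S ∪ T) + inside L (S ∩ T)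
inside-supermodular L S T = subst₂ _≤_ (total-+ _ _ L) (total-+ _ _ L)
  (total-mono _ _ L λ { {i , j} _ → edgewise (S i) (S j) (T i) (T j) })
  where
  edgewise : ∀ s s′ t t′ → bit (s ∧ s′) + bit (t ∧ t′) ≤ bit ((s ∨ t) ∧ (s′ ∨ t′)) + bit ((s ∧ t) ∧ (s′ ∧ t′))
  edgewise true true t t′ = ≤-refl
  edgewise true false true true = s≤s z≤n
  edgewise true false true false = z≤n
  edgewise true false false t′ = z≤n
  edgewise false true true true = s≤s z≤n
  edgewise false false true true = s≤s z≤n
  edgewise false s′ true false = z≤n
  edgewise false s′ false t′ = z≤n

2≤size : ∀ {V i j} S → i ≢ j → i ∈ V → j ∈ V → S i ≡ true → S j ≡ true → 2 ≤ size V S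
2≤size {V} {i} {j} S i≢j i∈ j∈ Si Sj = ≤-trans (+-mono-≤ (1≤total-δ i∈) (1≤total-δ j∈))
  (subst (_≤ size V S) (total-+ (δ i) (δ j) V) (total-mono _ _ V λ {x} _ → pointwise x))
  where
  pointwise : ∀ x → δ i x + δ j x ≤ bit (S x)
  pointwise x with x ≟ i | x ≟ j
  ... | yes refl | yes refl = contradiction refl i≢j
  ... | yes refl | no q = ≤-reflexive (trans (cong₂ _+_ (δ-same i) (δ-diff q)) (cong bit (sym Si)))
  ... | no p | yes refl = ≤-reflexive (trans (cong₂ _+_ (δ-diff p) (δ-same j)) (cong bit (sym Sj)))
  ... | no p | no q = ≤-trans (≤-reflexive (cong₂ _+_ (δ-diff p) (δ-diff q))) z≤n

_[_≔_] : (ℕ → Bool) → ℕ → Bool → ℕ → Bool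
(S [ v ≔ b ]) x = if does (x ≟ v) then b else S x

≔-same : ∀ S v b → (S [ v ≔ b ]) v ≡ b
≔-same S v b = cong (if_then b else S v) (dec-true (v ≟ v) refl)

≔-diff : ∀ S v b {x} → x ≢ v → (S [ v ≔ b ]) x ≡ S x
≔-diff S v b {x} p = cong (if_then b else S x) (dec-false (x ≟ v) p)

≔-self : ∀ S v x → (S [ v ≔ S v ]) x ≡ S x
≔-self S v x with x ≟ v
... | yes refl = ≔-same S v (S v)
... | no p = ≔-diff S v (S v) p

size-cong : ∀ {V S T} → (∀ {x} → x ∈ V → S x ≡ T x) → size V S ≡ size V T
size-cong {V} h = total-cong _ _ V (cong bit ∘ h)

inside-cong : ∀ {V L S T} → L On V → (∀ {x} → x ∈ V → S x ≡ T x) → inside L S ≡ inside L T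
inside-cong {L = L} on h = total-cong _ _ L λ p →
  cong bit (cong₂ _∧_ (h (proj₁ (All.lookup on p))) (h (proj₂ (All.lookup on p))))

-- The value at each vertex of `V` is fixed in turn. Values outside `V` are irrelevant by `resp`, so
-- this exhausts all cases although `S` ranges over functions on all naturals.
search : ∀ V (P : (ℕ → Bool) → Set) → (∀ S → Dec (P S)) →
  (∀ {S T} → (∀ {x} → x ∈ V → S x ≡ T x) → P S → P T) → Dec (Σ[ S ∈ (ℕ → Bool) ] P S)
search [] P P? resp with P? (λ _ → false)
... | yes p = yes (_ , p)
... | no ¬p = no λ (S , p) → ¬p (resp (λ ()) p)
search (v ∷ V) P P? resp with at true | at false
  where
  at : ∀ b → Dec (Σ[ S ∈ (ℕ → Bool) ] P (S [ v ≔ b ]))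
  at b = search V _ (λ S → P? _) λ {S} {T} h → resp λ where
    (here refl) → trans (≔-same S v b) (sym (≔-same T v b))
    {x} (there p) → cong (λ z → if does (x ≟ v) then b else z) (h p)
... | yes (S , p) | _ = yes (_ , p)
... | no _ | yes (S , p) = yes (_ , p)
... | no ¬t | no ¬f = no λ (S , p) → by-value S p (S v) refl
  where
  by-value : ∀ S → P S → ∀ b → S v ≡ b → ⊥
  by-value S p true eq = ¬t (S , resp (λ {x} _ → sym (trans (cong (λ b → (S [ v ≔ b ]) x) (sym eq)) (≔-self S v x))) p)
  by-value S p false eq = ¬f (S , resp (λ {x} _ → sym (trans (cong (λ b → (S [ v ≔ b ]) x) (sym eq)) (≔-self S v x))) p)

-- Low-degree vertices and their stars

degree : List E → ℕ → ℕ
degree L v = total (λ (i , j) → δ i v + δ j v) L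

handshake : ∀ {V} → Unique V → ∀ L → total (degree L) V ≤ length L * 2
handshake {V} u [] = ≤-reflexive (trans (total-const 0 V) (*-zeroʳ (length V)))
handshake {V} u ((i , j) ∷ L) = ≤-trans (≤-reflexive (trans (total-+ _ (degree L) V) (cong (_+ total (degree L) V) (total-+ (δ i) (δ j) V))))
  (+-mono-≤ (+-mono-≤ (total-δ≤1 u) (total-δ≤1 u)) (handshake u L))

-- If every degree were at least 4, the degree sum would give 4|V| ≤ 2|L| ≤ 4|V| - 6.
low-degree : ∀ {V L} → Unique V → length L + 3 ≤ 2 * length V → Σ[ v ∈ ℕ ] v ∈ V × degree L v ≤ 3
low-degree {V} {L} u bound with Any.any? (λ v → degree L v ≤? 3) V
... | yes p = let v , v∈ , d = find p in v , v∈ , d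
... | no ¬p = contradiction (begin
  length V * 4             ≡⟨ sym (total-const 4 V) ⟩
  total (λ _ → 4) V        ≤⟨ total-mono (λ _ → 4) (degree L) V (λ v∈ → ≰⇒> λ d → ¬p (lose v∈ d)) ⟩
  total (degree L) V       ≤⟨ handshake u L ⟩
  length L * 2             ∎) (<⇒≱ (begin-strict
  length L * 2             <⟨ m<m+n (length L * 2) (s≤s z≤n) ⟩
  length L * 2 + 6         ≡⟨ sym (*-distribʳ-+ 2 (length L) 3) ⟩
  (length L + 3) * 2       ≤⟨ *-monoˡ-≤ 2 bound ⟩
  2 * length V * 2         ≡⟨ cong (_* 2) (*-comm 2 (length V)) ⟩
  length V * 2 * 2         ≡⟨ *-assoc (length V) 2 2 ⟩
  length V * 4             ∎))
  where open ≤-Reasoning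

-- The edge list split into the edges at `v` and the others, which is the shape of the result of a
-- 0- or 1-extension at `v`.
record Star (v : ℕ) (L : List E) : Set where
  field
    nbrs : List ℕ
    rest : List E
    perm : L ↭ spokes v nbrs ++ rest
    avoids : Avoids v rest
    count : length nbrs ≤ degree L v

star : ∀ v {L} → Proper L → Star v L
star v [] = record { nbrs = [] ; rest = [] ; perm = ↭-refl ; avoids = [] ; count = z≤n }
star v {(i , j) ∷ L} (lt ∷ ps) = by-cases (v ≟ i) (v ≟ j)
  where
  open Star (star v ps)
  add-spoke : ∀ x → ⟪ v , x ⟫ ≡ (i , j) → 1 ≤ δ i v + δ j v → Star v ((i , j) ∷ L)
  add-spoke x eq d = record
    { nbrs = x ∷ nbrs ; rest = rest
    ; perm = subst (λ e → e ∷ L ↭ spokes v (x ∷ nbrs) ++ rest) eq (prep _ perm)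
    ; avoids = avoids ; count = +-mono-≤ d count }
  by-cases : Dec (v ≡ i) → Dec (v ≡ j) → Star v ((i , j) ∷ L)
  by-cases (yes refl) _ = add-spoke j (⟪⟫-< lt) (≤-trans (≤-reflexive (sym (δ-same v))) (m≤m+n _ (δ j v)))
  by-cases (no _) (yes refl) = add-spoke i (⟪⟫-> lt) (≤-trans (≤-reflexive (sym (δ-same v))) (m≤n+m _ (δ i v)))
  by-cases (no p) (no q) = record
    { nbrs = nbrs ; rest = (i , j) ∷ rest
    ; perm = ↭-trans (prep _ perm) (↭-sym (shift (i , j) (spokes v nbrs) rest))
    ; avoids = (p , q) ∷ avoids ; count = ≤-trans count (m≤n+m _ (δ i v + δ j v)) }

total-++ : ∀ (f : A → ℕ) xs ys → total f (xs ++ ys) ≡ total f xs + total f ys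
total-++ f xs ys = trans (cong sum (map-++ f xs ys)) (sum-++ (map f xs) (map f ys))

total-↭ : ∀ (f : A → ℕ) {xs ys} → xs ↭ ys → total f xs ≡ total f ys
total-↭ f p = sum-↭ (map⁺ f p)

-- Combining tight sets

module _ {V : List ℕ} {L : List E} (sparse : Sparse V L) where

  -- Sizes are modular and edge counts supermodular, so union and intersection together are as tight
  -- as `S` and `T`. Sparsity of the intersection, available once it has two vertices, leaves the
  -- tightness to the union.
  ∪-tight : ∀ {S T} → Tight V L S → Tight V L T → 2 ≤ size V (S ∩ T) → Tight V L (S ∪ T)
  ∪-tight {S} {T} tS tT 2≤ = +-cancelʳ-≤ (2 * size V (S ∩ T)) _ _ (begin
    2 * size V (S ∪ T) + 2 * size V (S ∩ T)       ≡⟨ sym (*-distribˡ-+ 2 (size V (S ∪ T)) (size V (S ∩ T))) ⟩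
    2 * (size V (S ∪ T) + size V (S ∩ T))         ≡⟨ cong (2 *_) (sym (size-modular V S T)) ⟩
    2 * (size V S + size V T)                     ≡⟨ *-distribˡ-+ 2 (size V S) (size V T) ⟩
    2 * size V S + 2 * size V T                   ≤⟨ +-mono-≤ tS tT ⟩
    (inside L S + 3) + (inside L T + 3)           ≡⟨ gather (inside L S) (inside L T) ⟩
    (inside L S + inside L T) + 6                 ≤⟨ +-monoˡ-≤ 6 (inside-supermodular L S T) ⟩
    (inside L (S ∪ T) + inside L (S ∩ T)) + 6     ≡⟨ sym (gather (inside L (S ∪ T)) (inside L (S ∩ T))) ⟩
    (inside L (S ∪ T) + 3) + (inside L (S ∩ T) + 3) ≤⟨ +-monoʳ-≤ (inside L (S ∪ T) + 3) (sparse (S ∩ T) 2≤) ⟩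
    (inside L (S ∪ T) + 3) + 2 * size V (S ∩ T)   ∎)
    where
    open ≤-Reasoning
    gather : ∀ x y → (x + 3) + (y + 3) ≡ (x + y) + 6
    gather = solve-∀

-- Three tight sets on the sides of a triangle that pairwise share no edge: the three corners are
-- counted twice, which gains exactly the slack needed for tightness of the union.
triangle-tight : ∀ {V L S T R a b c} → Proper L → L On V →
  a ∈ V → b ∈ V → c ∈ V → a ≢ b → a ≢ c → b ≢ c →
  S a ≡ true → S b ≡ true → T a ≡ true → T c ≡ true → R b ≡ true → R c ≡ true →
  ¬ 2 ≤ size V (S ∩ T) → ¬ 2 ≤ size V (S ∩ R) → ¬ 2 ≤ size V (T ∩ R) →
  Tight V L S → Tight V L T → Tight V L R → Tight V L ((S ∪ T) ∪ R)
triangle-tight {V} {L} {S} {T} {R} {a} {b} {c} pr on a∈ b∈ c∈ a≢b a≢c b≢c Sa Sb Ta Tc Rb Rc ¬ST ¬SR ¬TR tS tT tR =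
  +-cancelʳ-≤ 6 _ _ (begin
    2 * size V U + 6                                              ≡⟨ sym (*-distribˡ-+ 2 (size V U) 3) ⟩
    2 * (size V U + 3)                                            ≤⟨ *-monoʳ-≤ 2 sizes ⟩
    2 * (size V S + size V T + size V R)                          ≡⟨ expand (size V S) (size V T) (size V R) ⟩
    2 * size V S + 2 * size V T + 2 * size V R                    ≤⟨ +-mono-≤ (+-mono-≤ tS tT) tR ⟩
    (inside L S + 3) + (inside L T + 3) + (inside L R + 3)        ≡⟨ gather (inside L S) (inside L T) (inside L R) ⟩
    (inside L S + inside L T + inside L R) + 9                    ≤⟨ +-monoˡ-≤ 9 insides ⟩
    inside L U + 9                                                ≡⟨ sym (+-assoc (inside L U) 3 6) ⟩
    (inside L U + 3) + 6                                          ∎)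
  where
  open ≤-Reasoning
  U = (S ∪ T) ∪ R
  expand : ∀ x y z → 2 * (x + y + z) ≡ 2 * x + 2 * y + 2 * z
  expand = solve-∀
  gather : ∀ x y z → (x + 3) + (y + 3) + (z + 3) ≡ (x + y + z) + 9
  gather = solve-∀

  -- A common edge would put its two distinct ends into the intersection.
  disjoint : ∀ X Y → ¬ 2 ≤ size V (X ∩ Y) → ∀ {e} → e ∈ L → covers X e ≡ true → covers Y e ≡ true → ⊥
  disjoint X Y small {i , j} e∈ p q = small (2≤size (X ∩ Y) (<⇒≢ (All.lookup pr e∈))
    (proj₁ (All.lookup on e∈)) (proj₂ (All.lookup on e∈)) (cong₂ _∧_ Xi Yi) (cong₂ _∧_ Xj Yj))
    where
    Xi = proj₁ (∧-true {X i} {X j} p)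
    Xj = proj₂ (∧-true {X i} {X j} p)
    Yi = proj₁ (∧-true {Y i} {Y j} q)
    Yj = proj₂ (∧-true {Y i} {Y j} q)

  insides : inside L S + inside L T + inside L R ≤ inside L U
  insides = subst (_≤ inside L U) (trans (total-+ _ _ L) (cong (_+ inside L R) (total-+ _ _ L))) (total-mono _ _ L λ { {e} e∈ →
      edgewise e (covers S e) (covers T e) (covers R e) refl refl refl (disjoint S T ¬ST e∈) (disjoint S R ¬SR e∈) (disjoint T R ¬TR e∈) })
    where
    ∨-introʳ : ∀ x {y} → y ≡ true → x ∨ y ≡ true
    ∨-introʳ true _ = refl
    ∨-introʳ false p = p
    ∨-introˡ : ∀ {x} y → x ≡ true → x ∨ y ≡ true
    ∨-introˡ y refl = refl
    covered : ∀ e {X} → (∀ {x} → X x ≡ true → U x ≡ true) → covers X e ≡ true → 1 ≤ bit (covers U e)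
    covered (i , j) {X} h p = ≤-reflexive (sym (cong bit (cong₂ _∧_
      (h (proj₁ (∧-true {X i} {X j} p))) (h (proj₂ (∧-true {X i} {X j} p))))))
    edgewise : ∀ e s t r → covers S e ≡ s → covers T e ≡ t → covers R e ≡ r →
      (covers S e ≡ true → covers T e ≡ true → ⊥) → (covers S e ≡ true → covers R e ≡ true → ⊥) →
      (covers T e ≡ true → covers R e ≡ true → ⊥) →
      bit s + bit t + bit r ≤ bit (covers U e)
    edgewise e true true r p q _ h _ _ = ⊥-elim (h p q)
    edgewise e true false true p _ q _ h _ = ⊥-elim (h p q)
    edgewise e false true true _ p q _ _ h = ⊥-elim (h p q)
    edgewise e true false false p _ _ _ _ _ = covered e {S} (λ {x} → ∨-introˡ (R x) ∘ ∨-introˡ (T x)) p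
    edgewise e false true false _ p _ _ _ _ = covered e {T} (λ {x} → ∨-introˡ (R x) ∘ ∨-introʳ (S x)) p
    edgewise e false false true _ _ p _ _ _ = covered e {R} (λ {x} → ∨-introʳ (S x ∨ T x)) p
    edgewise e false false false _ _ _ _ _ _ = z≤n

  sizes : size V U + 3 ≤ size V S + size V T + size V R
  sizes = begin
    size V U + (1 + 1 + 1)                                      ≤⟨ +-monoʳ-≤ (size V U) (+-mono-≤ (+-mono-≤ (1≤total-δ a∈) (1≤total-δ b∈)) (1≤total-δ c∈)) ⟩
    size V U + (total (δ a) V + total (δ b) V + total (δ c) V)  ≡⟨ cong (size V U +_) (sym (trans (total-+ _ _ V) (cong (_+ total (δ c) V) (total-+ _ _ V)))) ⟩
    size V U + total (λ x → δ a x + δ b x + δ c x) V            ≡⟨ sym (total-+ _ _ V) ⟩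
    total (λ x → bit (U x) + (δ a x + δ b x + δ c x)) V         ≤⟨ total-mono _ _ V (λ {x} _ → pointwise x (x ≟ a) (x ≟ b) (x ≟ c)) ⟩
    total (λ x → bit (S x) + bit (T x) + bit (R x)) V           ≡⟨ trans (total-+ _ _ V) (cong (_+ size V R) (total-+ _ _ V)) ⟩
    size V S + size V T + size V R                              ∎
    where
    bit≤1 : ∀ x → bit x ≤ 1
    bit≤1 true = s≤s z≤n
    bit≤1 false = z≤n
    corner : ∀ x {d} → d ≡ 1 → 2 ≤ bit (S x) + bit (T x) + bit (R x) → bit (U x) + d ≤ bit (S x) + bit (T x) + bit (R x)
    corner x refl h = ≤-trans (+-monoˡ-≤ 1 (bit≤1 (U x))) h
    δs : ∀ x {d₁ d₂ d₃} → δ a x ≡ d₁ → δ b x ≡ d₂ → δ c x ≡ d₃ → δ a x + δ b x + δ c x ≡ d₁ + d₂ + d₃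
    δs x p q r = cong₂ _+_ (cong₂ _+_ p q) r
    pointwise : ∀ x → Dec (x ≡ a) → Dec (x ≡ b) → Dec (x ≡ c) →
      bit (U x) + (δ a x + δ b x + δ c x) ≤ bit (S x) + bit (T x) + bit (R x)
    pointwise x (yes refl) _ _ = corner x (δs x (δ-same x) (δ-diff a≢b) (δ-diff a≢c))
      (subst₂ (λ s t → 2 ≤ bit s + bit t + bit (R x)) (sym Sa) (sym Ta) (s≤s (s≤s z≤n)))
    pointwise x (no p) (yes refl) _ = corner x (δs x (δ-diff p) (δ-same x) (δ-diff b≢c))
      (subst₂ (λ s r → 2 ≤ bit s + bit (T x) + bit r) (sym Sb) (sym Rb) (s≤s (m≤n+m 1 (bit (T x)))))
    pointwise x (no p) (no q) (yes refl) = corner x (δs x (δ-diff p) (δ-diff q) (δ-same x))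
      (subst₂ (λ t r → 2 ≤ bit (S x) + bit t + bit r) (sym Tc) (sym Rc) (≤-trans (m≤n+m 2 (bit (S x))) (≤-reflexive (sym (+-assoc (bit (S x)) 1 1)))))
    pointwise x (no p) (no q) (no r) = ≤-trans (≤-reflexive (trans (cong (bit (U x) +_) (δs x (δ-diff p) (δ-diff q) (δ-diff r))) (+-identityʳ _)))
      (≤-trans (bit-∨ (S x ∨ T x) (R x)) (+-monoˡ-≤ (bit (R x)) (bit-∨ (S x) (T x))))

-- Sparsity under deleting a vertex and adding an edge

module _ {v : ℕ} {V N : List ℕ} {L : List E} (u : Unique (v ∷ V)) (N⊆V : N ⊆ V) (on : L On V)
  (sparse : Sparse (v ∷ V) (spokes v N ++ L)) where

  private
    v∉V : v ∉ V
    v∉V = Unique.Unique[x∷xs]⇒x∉xs u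

    outside : ∀ S b {x} → x ∈ V → (S [ v ≔ b ]) x ≡ S x
    outside S b p = ≔-diff S v b λ { refl → v∉V p }

    size-≔ : ∀ S b → size (v ∷ V) (S [ v ≔ b ]) ≡ bit b + size V S
    size-≔ S b = cong₂ _+_ (cong bit (≔-same S v b)) (size-cong {V} (outside S b))

    inside-≔ : ∀ S b → inside (spokes v N ++ L) (S [ v ≔ b ]) ≡ inside (spokes v N) (S [ v ≔ b ]) + inside L S
    inside-≔ S b = trans (total-++ _ (spokes v N) L)
      (cong (inside (spokes v N) (S [ v ≔ b ]) +_) (inside-cong on (outside S b)))

  -- A test set on `V` may happen to hold at `v`; resetting it to false there makes its size on
  -- `v ∷ V` agree with its size on `V`.
  Sparse-delete : Sparse V L
  Sparse-delete S 2≤ = ≤-trans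
    (+-monoˡ-≤ 3 (≤-trans (m≤n+m (inside L S) _) (≤-reflexive (sym (inside-≔ S false)))))
    (subst (λ k → inside (spokes v N ++ L) (S [ v ≔ false ]) + 3 ≤ 2 * k) (size-≔ S false)
      (sparse (S [ v ≔ false ]) (subst (2 ≤_) (sym (size-≔ S false)) 2≤)))

  -- Adding `v` to such a set would bring at least three edges while the bound grows only by two.
  no-tight-⊇nbrs : ∀ {S} → 3 ≤ length N → 1 ≤ size V S → (∀ {x} → x ∈ N → S x ≡ true) → ¬ Tight V L S
  no-tight-⊇nbrs {S} 3≤ 1≤ N⊆S tight = <⇒≱ (n<1+n (inside L S + 5)) (begin
    suc (inside L S + 5)                                ≡⟨ arith (inside L S) ⟩
    3 + inside L S + 3                                  ≤⟨ +-monoˡ-≤ 3 (+-monoˡ-≤ (inside L S) (≤-trans 3≤ (≤-reflexive (sym (all-in N N⊆V N⊆S))))) ⟩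
    inside (spokes v N) S⁺ + inside L S + 3             ≡⟨ cong (_+ 3) (sym (inside-≔ S true)) ⟩
    inside (spokes v N ++ L) S⁺ + 3                     ≤⟨ sparse S⁺ (subst (2 ≤_) (sym (size-≔ S true)) (s≤s 1≤)) ⟩
    2 * size (v ∷ V) S⁺                                 ≡⟨ cong (2 *_) (size-≔ S true) ⟩
    2 * suc (size V S)                                  ≡⟨ *-suc 2 (size V S) ⟩
    2 + 2 * size V S                                    ≤⟨ +-monoʳ-≤ 2 tight ⟩
    2 + (inside L S + 3)                                ≡⟨ arith′ (inside L S) ⟩
    inside L S + 5                                      ∎)
    where
    open ≤-Reasoning
    S⁺ = S [ v ≔ true ]
    arith : ∀ i → suc (i + 5) ≡ 3 + i + 3
    arith = solve-∀
    arith′ : ∀ i → 2 + (i + 3) ≡ i + 5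
    arith′ = solve-∀
    all-in : ∀ M → M ⊆ V → (∀ {x} → x ∈ M → S x ≡ true) → inside (spokes v M) S⁺ ≡ length M
    all-in [] _ _ = refl
    all-in (x ∷ M) sub h = cong₂ _+_
      (cong bit (trans (covers-⟪⟫ S⁺ v x) (cong₂ _∧_ (≔-same S v true) (trans (outside S true (sub (here refl))) (h (here refl))))))
      (all-in M (sub ∘ there) (h ∘ there))

Blocked : List ℕ → List E → ℕ → ℕ → Set
Blocked V L x y = Σ[ S ∈ (ℕ → Bool) ] S x ≡ true × S y ≡ true × Tight V L S

blocked? : ∀ {V L x y} → L On V → x ∈ V → y ∈ V → Dec (Blocked V L x y)
blocked? {V} {L} {x} {y} on x∈ y∈ = search V _
  (λ S → (S x Bool.≟ true) ×-dec (S y Bool.≟ true) ×-dec (2 * size V S ≤? inside L S + 3))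
  λ h (p , q , t) → trans (sym (h x∈)) p , trans (sym (h y∈)) q
    , subst₂ (λ s i → 2 * s ≤ i + 3) (size-cong {V} h) (inside-cong on h) t

module _ {V : List ℕ} {L : List E} {x y : ℕ} (uV : Unique V) (sparse : Sparse V L) (free : ¬ Blocked V L x y) where

  -- If the edge were present, its two ends alone would form a tight set: 2 · 2 = 1 + 3.
  free⇒∉ : ⟪ x , y ⟫ ∉ L
  free⇒∉ p = free (pair , pair-x , pair-y , ≤-trans (*-monoʳ-≤ 2 small) (+-monoˡ-≤ 3 (one L p)))
    where
    pair : ℕ → Bool
    pair z = does (z ≟ x) ∨ does (z ≟ y)
    pair-x : pair x ≡ true
    pair-x = cong (_∨ does (x ≟ y)) (dec-true (x ≟ x) refl)
    pair-y : pair y ≡ true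
    pair-y = trans (cong (does (y ≟ x) ∨_) (dec-true (y ≟ y) refl)) (Bool.∨-zeroʳ _)
    small : size V pair ≤ 2
    small = ≤-trans (total-mono _ _ V λ {z} _ → bit-∨ (does (z ≟ x)) (does (z ≟ y)))
      (≤-trans (≤-reflexive (total-+ (δ x) (δ y) V)) (+-mono-≤ (total-δ≤1 uV) (total-δ≤1 uV)))
    one : ∀ M → ⟪ x , y ⟫ ∈ M → 1 ≤ inside M pair
    one (e ∷ M) (here refl) = ≤-trans
      (≤-reflexive (sym (cong bit (trans (covers-⟪⟫ pair x y) (cong₂ _∧_ pair-x pair-y))))) (m≤m+n _ (inside M pair))
    one (e ∷ M) (there q) = ≤-trans (one M q) (m≤n+m _ (bit (covers pair e)))

  -- Only sets containing both ends gain an edge. These are not tight, so the inequality is strict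
  -- for them and has room for it.
  Sparse-add : Sparse V (⟪ x , y ⟫ ∷ L)
  Sparse-add S 2≤ = by-value (S x) (S y) refl refl
    where
    by-value : ∀ s t → S x ≡ s → S y ≡ t → bit (covers S ⟪ x , y ⟫) + inside L S + 3 ≤ 2 * size V S
    by-value true true p q = subst (λ b → bit b + inside L S + 3 ≤ 2 * size V S)
      (sym (trans (covers-⟪⟫ S x y) (cong₂ _∧_ p q))) (≰⇒> λ t → free (S , p , q , t))
    by-value true false p q = subst (λ b → bit b + inside L S + 3 ≤ 2 * size V S)
      (sym (trans (covers-⟪⟫ S x y) (cong₂ _∧_ p q))) (sparse S 2≤)
    by-value false t p q = subst (λ b → bit b + inside L S + 3 ≤ 2 * size V S)
      (sym (trans (covers-⟪⟫ S x y) (cong₂ _∧_ p q))) (sparse S 2≤)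

-- Henneberg induction

⟪⟫-proper : ∀ {i j} → i ≢ j → proj₁ ⟪ i , j ⟫ < proj₂ ⟪ i , j ⟫
⟪⟫-proper {i} {j} i≢j = proj₁ (⟪⟫-within {n = suc (i + j)} i≢j (s≤s (m≤m+n i j)) (s≤s (m≤n+m j i)))

⟪⟫-endʳ : ∀ {p} {P : ℕ → Set p} i j → P (proj₁ ⟪ i , j ⟫) → P (proj₂ ⟪ i , j ⟫) → P j
⟪⟫-endʳ {P = P} i j p q with ⊔-sel i j
... | inj₂ eq = subst P eq q
... | inj₁ eq = subst P (m≥n⇒m⊓n≡n (≤-trans (m≤n⊔m i j) (≤-reflexive eq))) p

∨-true : ∀ {s t} → s ≡ true ⊎ t ≡ true → s ∨ t ≡ true
∨-true (inj₁ refl) = refl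
∨-true {s} (inj₂ refl) = Bool.∨-zeroʳ s

module Henneberg (F : RigidityFamily2) where
  open Independence F
  open Ind
  open Extensions F
  open OneExtension F

  Ind-spokes-⊆ : ∀ {v xs ys L} → Avoids v L → Unique ys → ys ⊆ xs → Ind (spokes v xs ++ L) → Ind (spokes v ys ++ L)
  Ind-spokes-⊆ {v} {xs} {ys} av u sub I = Ind-⊆ (spokes-unique av (proj₁ (proj₂ (Unique-++⁻ (spokes v xs) (unique I)))) u)
    (λ p → [ (λ q → ∈-++⁺ˡ (Subset.map⁺ ⟪ v ,_⟫ sub q)) , ∈-++⁺ʳ (spokes v xs) ]′ (∈-++⁻ (spokes v ys) p)) I

  module _ (K : Ind K33-edges) where

    module _ {v : ℕ} {V : List ℕ} {L : List E} (u : Unique (v ∷ V)) (uL : Unique L) (pr : Proper L) (on : L On V)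
      (Ind-sparse : ∀ {L′} → Unique L′ → Proper L′ → L′ On V → Sparse V L′ → Ind L′) where

      v∉V : v ∉ V
      v∉V = Unique.Unique[x∷xs]⇒x∉xs u

      av : Avoids v L
      av = ∉⇒Avoids v∉V on

      module _ {a b c : ℕ} (uN : Unique (a ∷ b ∷ c ∷ [])) (N⊆V : a ∷ b ∷ c ∷ [] ⊆ V)
        (sparse : Sparse (v ∷ V) (spokes v (a ∷ b ∷ c ∷ []) ++ L)) where

        sparse′ : Sparse V L
        sparse′ = Sparse-delete u N⊆V on sparse

        -- The reverse of the 1-extension: `xy` joins `L`, the induction hypothesis applies to the
        -- result, and `xy` is then replaced by the three spokes. The names `x`, `y`, `z` permit any
        -- choice of the pair among `a`, `b`, `c`.
        split-pair : ∀ {x y z} → Unique (x ∷ y ∷ z ∷ []) → x ∷ y ∷ z ∷ [] ⊆ V → a ∷ b ∷ c ∷ [] ⊆ x ∷ y ∷ z ∷ [] →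
          ¬ Blocked V L x y → Ind (spokes v (a ∷ b ∷ c ∷ []) ++ L)
        split-pair {x} {y} {z} ((x≢y ∷ x≢z ∷ []) ∷ (y≢z ∷ []) ∷ _) xyz⊆ N⊆ free = Ind-spokes-⊆ av uN N⊆
          (1-extension K (Ind-sparse
              (All.tabulate (λ { p refl → free⇒∉ (AllPairs.tail u) sparse′ free p }) ∷ uL)
              (⟪⟫-proper x≢y ∷ pr)
              (⟪⟫-ends {P = _∈ V} (xyz⊆ (here refl)) (xyz⊆ (there (here refl))) ∷ on)
              (Sparse-add {V} {L} (AllPairs.tail u) sparse′ free))
            av (v∉V ∘ xyz⊆) x≢y x≢z y≢z)

        -- If two of the sets share two vertices, their union is tight; otherwise `triangle-tight`
        -- makes the union of all three tight. Either union contains all neighbours of `v`, contrary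
        -- to `no-tight-⊇nbrs`.
        not-all-blocked : Blocked V L a b → Blocked V L a c → Blocked V L b c → ⊥
        not-all-blocked (S , Sa , Sb , tS) (T , Ta , Tc , tT) (R , Rb , Rc , tR) =
          by-overlap (2 ≤? size V (S ∩ T)) (2 ≤? size V (S ∩ R)) (2 ≤? size V (T ∩ R))
          where
          a≢b = All.head (AllPairs.head uN)
          a≢c = All.head (All.tail (AllPairs.head uN))
          b≢c = All.head (AllPairs.head (AllPairs.tail uN))
          a∈ = N⊆V (here refl)
          b∈ = N⊆V (there (here refl))
          c∈ = N⊆V (there (there (here refl)))
          refute : ∀ U → U a ≡ true → U b ≡ true → U c ≡ true → ¬ Tight V L U
          refute U Ua Ub Uc = no-tight-⊇nbrs u N⊆V on sparse ≤-refl
            (≤-trans (s≤s z≤n) (2≤size U a≢b a∈ b∈ Ua Ub))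
            λ { (here refl) → Ua ; (there (here refl)) → Ub ; (there (there (here refl))) → Uc }
          by-overlap : Dec (2 ≤ size V (S ∩ T)) → Dec (2 ≤ size V (S ∩ R)) → Dec (2 ≤ size V (T ∩ R)) → ⊥
          by-overlap (yes p) _ _ = refute (S ∪ T) (∨-true (inj₁ Sa)) (∨-true (inj₁ Sb)) (∨-true {S c} (inj₂ Tc)) (∪-tight {V} {L} sparse′ {S} {T} tS tT p)
          by-overlap (no _) (yes p) _ = refute (S ∪ R) (∨-true (inj₁ Sa)) (∨-true (inj₁ Sb)) (∨-true {S c} (inj₂ Rc)) (∪-tight {V} {L} sparse′ {S} {R} tS tR p)
          by-overlap (no _) (no _) (yes p) = refute (T ∪ R) (∨-true (inj₁ Ta)) (∨-true {T b} (inj₂ Rb)) (∨-true (inj₁ Tc)) (∪-tight {V} {L} sparse′ {T} {R} tT tR p)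
          by-overlap (no p) (no q) (no r) = refute ((S ∪ T) ∪ R)
            (∨-true (inj₁ (∨-true (inj₁ Sa)))) (∨-true (inj₁ (∨-true (inj₁ Sb)))) (∨-true {S c ∨ T c} (inj₂ Rc))
            (triangle-tight {S = S} {T} {R} pr on a∈ b∈ c∈ a≢b a≢c b≢c Sa Sb Ta Tc Rb Rc p q r tS tT tR)

        add-3-valent : Ind (spokes v (a ∷ b ∷ c ∷ []) ++ L)
        add-3-valent = by-blocked uN
          (blocked? on (N⊆V (here refl)) (N⊆V (there (here refl))))
          (blocked? on (N⊆V (here refl)) (N⊆V (there (there (here refl)))))
          (blocked? on (N⊆V (there (here refl))) (N⊆V (there (there (here refl)))))
          where
          acb : a ∷ c ∷ b ∷ [] ⊆ a ∷ b ∷ c ∷ []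
          acb (here refl) = here refl
          acb (there (here refl)) = there (there (here refl))
          acb (there (there (here refl))) = there (here refl)
          acb′ : a ∷ b ∷ c ∷ [] ⊆ a ∷ c ∷ b ∷ []
          acb′ (here refl) = here refl
          acb′ (there (here refl)) = there (there (here refl))
          acb′ (there (there (here refl))) = there (here refl)
          bca : b ∷ c ∷ a ∷ [] ⊆ a ∷ b ∷ c ∷ []
          bca (here refl) = there (here refl)
          bca (there (here refl)) = there (there (here refl))
          bca (there (there (here refl))) = here refl
          bca′ : a ∷ b ∷ c ∷ [] ⊆ b ∷ c ∷ a ∷ []
          bca′ (here refl) = there (there (here refl))
          bca′ (there (here refl)) = here refl
          bca′ (there (there (here refl))) = there (here refl)
          by-blocked : Unique (a ∷ b ∷ c ∷ []) → Dec (Blocked V L a b) → Dec (Blocked V L a c) → Dec (Blocked V L b c) →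
            Ind (spokes v (a ∷ b ∷ c ∷ []) ++ L)
          by-blocked un (no p) _ _ = split-pair un N⊆V id p
          by-blocked ((a≢b ∷ a≢c ∷ []) ∷ (b≢c ∷ []) ∷ _) (yes _) (no p) _ =
            split-pair ((a≢c ∷ a≢b ∷ []) ∷ ((b≢c ∘ sym) ∷ []) ∷ [] ∷ []) (N⊆V ∘ acb) acb′ p
          by-blocked ((a≢b ∷ a≢c ∷ []) ∷ (b≢c ∷ []) ∷ _) (yes _) (yes _) (no p) =
            split-pair ((b≢c ∷ (a≢b ∘ sym) ∷ []) ∷ ((a≢c ∘ sym) ∷ []) ∷ [] ∷ []) (N⊆V ∘ bca) bca′ p
          by-blocked _ (yes p) (yes q) (yes r) = ⊥-elim (not-all-blocked p q r)

      add-vertex : ∀ N → Unique N → N ⊆ V → Sparse (v ∷ V) (spokes v N ++ L) → length N ≤ 3 → Ind (spokes v N ++ L)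
      add-vertex [] _ N⊆V sparse _ = Ind-sparse uL pr on (Sparse-delete {N = []} u N⊆V on sparse)
      -- A 0-extension attaches two spokes, so a second one goes to some `z` other than `v` and `a`
      -- and is dropped again.
      add-vertex (a ∷ []) uN N⊆V sparse _ = Ind-spokes-⊆ {xs = a ∷ proj₁ z ∷ []} av uN (λ { (here refl) → here refl })
        (0-extension (Ind-sparse uL pr on (Sparse-delete u N⊆V on sparse)) av
          (λ eq → proj₂ z (there (here (sym eq)))) (λ { refl → v∉V (N⊆V (here refl)) }) (λ eq → proj₂ z (here (sym eq))))
        where z = fresh (v ∷ a ∷ [])
      add-vertex (a ∷ b ∷ []) ((a≢b ∷ []) ∷ _) N⊆V sparse _ =
        0-extension-On v∉V (N⊆V (here refl)) (N⊆V (there (here refl))) a≢b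
          (Ind-sparse uL pr on (Sparse-delete u N⊆V on sparse)) on
      add-vertex (a ∷ b ∷ c ∷ []) uN N⊆V sparse _ = add-3-valent uN N⊆V sparse
      add-vertex (_ ∷ _ ∷ _ ∷ _ ∷ _) _ _ _ (s≤s (s≤s (s≤s ())))

    -- Sparsity applied to all of `V` bounds the number of edges, so a vertex of degree at most
    -- three exists. Once it stands at the front of `V` and its star at the front of `L`, the
    -- induction hypothesis concerns the remaining vertices.
    Sparse-step : ∀ {V L} → 2 ≤ length V → Unique V → Unique L → Proper L → L On V → Sparse V L →
      (∀ {V′ L′} → suc (length V′) ≡ length V → Unique V′ → Unique L′ → Proper L′ →
        L′ On V′ → Sparse V′ L′ → Ind L′) → Ind L
    Sparse-step {V} {L} 2≤ uV uL pr on sparse IH = at-vertex (low-degree {V} {L} uV bound)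
      where
      everything : size V (λ _ → true) ≡ length V
      everything = trans (total-const 1 V) (*-identityʳ (length V))
      bound : length L + 3 ≤ 2 * length V
      bound = subst₂ (λ l s → l + 3 ≤ 2 * s) (trans (total-const 1 L) (*-identityʳ (length L))) everything
        (sparse (λ _ → true) (subst (2 ≤_) (sym everything) 2≤))
      remove : ∀ v xs ys → V ≡ xs ++ v ∷ ys → degree L v ≤ 3 → Ind L
      remove v xs ys refl d = Ind-⊆ uL (∈-resp-↭ perm)
        (add-vertex uV′ uRest prRest onRest
          (IH (sym (↭-length V↭)) (AllPairs.tail uV′))
          nbrs (Unique.map⁻ (proj₁ split)) nbrs⊆ sparse↭ (≤-trans count d))
        where
        open Star (star v pr)
        V↭ : xs ++ v ∷ ys ↭ v ∷ xs ++ ys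
        V↭ = shift v xs ys
        uV′ : Unique (v ∷ xs ++ ys)
        uV′ = Unique-shuffle xs uV
        split : Unique (spokes v nbrs) × Unique rest × (∀ {z} → z ∈ spokes v nbrs → z ∉ rest)
        split = Unique-++⁻ (spokes v nbrs) (Unique-resp-↭ (setoid E) (↭⇒↭ₛ perm) uL)
        uRest = proj₁ (proj₂ split)
        pr′ : Proper (spokes v nbrs ++ rest)
        pr′ = All-resp-↭ perm pr
        prRest = All.++⁻ʳ (spokes v nbrs) pr′
        on′ : (spokes v nbrs ++ rest) On (v ∷ xs ++ ys)
        on′ = On-weaken (∈-resp-↭ V↭) (All-resp-↭ perm on)
        drop-v : ∀ {x} → v ≢ x → x ∈ v ∷ xs ++ ys → x ∈ xs ++ ys
        drop-v v≢x (here refl) = contradiction refl v≢x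
        drop-v v≢x (there p) = p
        onRest : rest On (xs ++ ys)
        onRest = All.tabulate λ p → let v≢i , v≢j = All.lookup avoids p ; i∈ , j∈ = All.lookup (All.++⁻ʳ (spokes v nbrs) on′) p in
          drop-v v≢i i∈ , drop-v v≢j j∈
        nbrs⊆ : nbrs ⊆ xs ++ ys
        nbrs⊆ {x} p = drop-v
          (λ { refl → <-irrefl (trans (⊓-idem v) (sym (⊔-idem v))) (All.lookup pr′ e∈) })
          (⟪⟫-endʳ {P = _∈ v ∷ xs ++ ys} v x (proj₁ (All.lookup on′ e∈)) (proj₂ (All.lookup on′ e∈)))
          where
          e∈ : ⟪ v , x ⟫ ∈ spokes v nbrs ++ rest
          e∈ = ∈-++⁺ˡ (∈-map⁺ ⟪ v ,_⟫ p)
        sparse↭ : Sparse (v ∷ xs ++ ys) (spokes v nbrs ++ rest)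
        sparse↭ S = subst₂ (λ i s → 2 ≤ s → i + 3 ≤ 2 * s) (total-↭ (bit ∘ covers S) perm) (total-↭ (bit ∘ S) V↭) (sparse S)
      at-vertex : Σ[ v ∈ ℕ ] v ∈ V × degree L v ≤ 3 → Ind L
      at-vertex (v , v∈ , d) with xs , ys , eq ← ∈-∃++ v∈ = remove v xs ys eq d

    -- Induction on the number of vertices, with `n` as the recursion measure. With fewer than two
    -- vertices no proper edge exists, and sparsity says nothing.
    Sparse⇒Ind : ∀ n {V L} → length V ≡ n → Unique V → Unique L → Proper L → L On V → Sparse V L → Ind L
    Sparse⇒Ind n {L = []} _ _ _ _ _ _ = Ind-[]
    Sparse⇒Ind zero {[]} {_ ∷ _} _ _ _ _ ((() , _) ∷ _) _
    Sparse⇒Ind (suc zero) {x ∷ []} {_ ∷ _} _ _ _ (lt ∷ _) ((here refl , here refl) ∷ _) _ = contradiction lt (<-irrefl refl)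
    Sparse⇒Ind (suc n@(suc _)) len uV uL pr on sparse = Sparse-step (subst (2 ≤_) (sym len) (s≤s (s≤s z≤n))) uV uL pr on sparse
      λ len′ → Sparse⇒Ind n (suc-injective (trans len′ len))

-- Translating `RIndep` and `K33` into edge lists

3≤double : ∀ {s} → 2 ≤ s → 3 ≤ 2 * s
3≤double 2≤ = ≤-trans (s≤s (s≤s (s≤s z≤n))) (*-monoʳ-≤ 2 2≤)

-- `H` is described only pointwise, so that it can be matched with the anonymous function inside
-- `induced`.
card-covered : (G H : Graph n) (S : ℕ → Bool) → (∀ e → H e ≡ covers S (toE e) ∧ G e) → card H ≡ inside (edgesOf G) S
card-covered {n} G H S h = count (allEdges n)
  where
  count : ∀ xs → total (λ e → if H e then 1 else 0) xs ≡
    inside (map toE (filter (λ e → G e Bool.≟ true) xs)) S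
  count [] = refl
  count (e ∷ xs) rewrite h e with G e
  ... | true = cong₂ _+_ (cong bit (Bool.∧-identityʳ (covers S (toE e)))) (count xs)
  ... | false = cong₂ _+_ (cong bit (Bool.∧-zeroʳ (covers S (toE e)))) (count xs)

subset : ∀ n → (ℕ → Bool) → Subset n
subset n S = Vec.tabulate (S ∘ toℕ)

∣subset∣ : ∀ n S → ∣ subset n S ∣ ≡ size (upTo n) S
∣subset∣ n S = go n id
  where
  go : ∀ m f → ∣ Vec.tabulate {n = m} (S ∘ f ∘ toℕ) ∣ ≡ size (applyUpTo f m) S
  go zero f = refl
  go (suc m) f with S (f 0)
  ... | true = cong suc (go m (f ∘ suc))
  ... | false = go m (f ∘ suc)

RIndep⇒Sparse : (G : Graph n) → RIndep G → Sparse (upTo n) (edgesOf G)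
RIndep⇒Sparse {n} G r S 2≤ = subst₂ (λ i s → i + 3 ≤ 2 * s) induced≡ (∣subset∣ n S)
  (≤-trans (+-monoˡ-≤ 3 (r P 2≤P)) (≤-reflexive (m∸n+n≡m (3≤double 2≤P))))
  where
  P = subset n S
  2≤P : 2 ≤ ∣ P ∣
  2≤P = subst (2 ≤_) (sym (∣subset∣ n S)) 2≤
  induced≡ : induced G P ≡ inside (edgesOf G) S
  induced≡ = card-covered G _ S λ e → trans
    (cong₂ (λ s t → s ∧ t ∧ G e) (Vec.lookup∘tabulate (S ∘ toℕ) (proj₁ e)) (Vec.lookup∘tabulate (S ∘ toℕ) (proj₁ (proj₂ e))))
    (sym (Bool.∧-assoc (S (toℕ (proj₁ e))) _ (G e)))

elements : Subset n → List ℕ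
elements [] = []
elements (b ∷ P) = if b then 0 ∷ map suc (elements P) else map suc (elements P)

length-elements : (P : Subset n) → length (elements P) ≡ ∣ P ∣
length-elements [] = refl
length-elements (true ∷ P) = cong suc (trans (length-map suc (elements P)) (length-elements P))
length-elements (false ∷ P) = trans (length-map suc (elements P)) (length-elements P)

elements-unique : (P : Subset n) → Unique (elements P)
elements-unique [] = []
elements-unique (true ∷ P) = All.map⁺ (All.universal (λ _ ()) _) ∷ Unique.map⁺ suc-injective (elements-unique P)
elements-unique (false ∷ P) = Unique.map⁺ suc-injective (elements-unique P)

∈-elements : (P : Subset n) (i : Fin n) → Vec.lookup P i ≡ true → toℕ i ∈ elements P
∈-elements (true ∷ P) Fin.zero p = here refl
∈-elements (true ∷ P) (Fin.suc i) p = there (∈-map⁺ suc (∈-elements P i p))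
∈-elements (false ∷ P) (Fin.suc i) p = ∈-map⁺ suc (∈-elements P i p)

unique? : (xs : List ℕ) → Dec (Unique xs)
unique? = AllPairs.allPairs? (λ x y → ¬? (x ≟ y))

K33-edges-unique : Unique K33-edges
K33-edges-unique = from-yes (AllPairs.allPairs? (λ x y → ¬? (≡-dec _≟_ _≟_ x y)) K33-edges)

-- Verified by evaluation on all fifteen edges.
K33-graph : ∀ e → K33 e ≡ graph 6 K33-edges e
K33-graph e = All.lookup (from-yes (All.all? (λ f → K33 f Bool.≟ graph 6 K33-edges f) (allEdges 6))) (∈-allEdges e)

module _ (x : E) where

  other? : ∀ y → Dec (¬ y ≡ x)
  other? y = ¬? (≡-dec _≟_ _≟_ y x)

  without : List E
  without = filter other? K33-edges

  without-unique : Unique without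
  without-unique = Unique.filter⁺ other? K33-edges-unique

  ∈-without⁺ : ∀ {y} → y ∈ K33-edges → y ≢ x → y ∈ without
  ∈-without⁺ = ∈-filter⁺ other?

  ∈-without⁻ : ∀ {y} → y ∈ without → y ∈ K33-edges
  ∈-without⁻ p = proj₁ (∈-filter⁻ other? {xs = K33-edges} p)

K33-edges-within : All (Within 6) K33-edges
K33-edges-within = from-yes (All.all? (λ (i , j) → (i <? j) ×-dec (j <? 6)) K33-edges)

-- The two halves of the circuit property

module Conclusion (F : RigidityFamily2) where
  open Independence F
  open Extensions F
  open Henneberg F

  Indep⇒RIndep : ∀ k (G : Graph (2 + k)) → Indep (M F k) G → RIndep G
  Indep⇒RIndep k G i P 2≤ = bound _ λ _ → refl
    where
    bound : ∀ H → (∀ e → H e ≡ Vec.lookup P (proj₁ e) ∧ Vec.lookup P (proj₁ (proj₂ e)) ∧ G e) → card H ≤ 2 * ∣ P ∣ ∸ 3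
    bound H h = subst₂ (λ c s → c ≤ 2 * s ∸ 3) (sym (card≡length H)) (length-elements P)
      (m+n≤o⇒m≤o∸n (length (edgesOf H)) (rank (elements-unique P) (subst (2 ≤_) (sym (length-elements P)) 2≤)
        (Ind-edgesOf k H (Indep-⊆ (M F k) (λ e p → proj₂ (∧-true {Vec.lookup P (proj₁ (proj₂ e))} (proj₂ (parts e p)))) i))
        (All.tabulate on)))
      where
      parts : ∀ e → H e ≡ true → Vec.lookup P (proj₁ e) ≡ true × Vec.lookup P (proj₁ (proj₂ e)) ∧ G e ≡ true
      parts e p = ∧-true (trans (sym (h e)) p)
      on : ∀ {x} → x ∈ edgesOf H → proj₁ x ∈ elements P × proj₂ x ∈ elements P
      on x∈ with e , refl , p ← ∈-edgesOf⁻ H x∈ =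
        ∈-elements P (proj₁ e) (proj₁ (parts e p)) , ∈-elements P (proj₁ (proj₂ e)) (proj₁ (∧-true (proj₂ (parts e p))))

  K33-indep⇒EqualsR : Indep (M F 4) K33 → EqualsR F
  K33-indep⇒EqualsR i k G = mk⇔ (Indep⇒RIndep k G) λ r → Indep-resp (M F k) (sym ∘ graph-edgesOf G)
    (indep-at (Sparse⇒Ind K33-Ind (2 + k) (length-upTo (2 + k)) (Unique.upTo⁺ (2 + k)) (edgesOf-unique G)
      (All.map proj₁ (edgesOf-within G)) (All.map (λ (p , q) → ∈-upTo⁺ (<-trans p q) , ∈-upTo⁺ q) (edgesOf-within G))
      (RIndep⇒Sparse G r)) k (edgesOf-within G))
    where
    K33-Ind : Ind K33-edges
    K33-Ind = ind 4 K33-edges-unique K33-edges-within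
      (Indep-resp (M F 4) K33-graph i)

  -- K₃,₃ minus the edge x y arises by attaching x₂, x₁, x and then y, each of degree two.
  module _ (x x₁ x₂ y y₁ y₂ : ℕ) where

    four-0-extensions : List E
    four-0-extensions = ⟪ y , x₁ ⟫ ∷ ⟪ y , x₂ ⟫ ∷ ⟪ x , y₁ ⟫ ∷ ⟪ x , y₂ ⟫ ∷
      ⟪ x₁ , y₁ ⟫ ∷ ⟪ x₁ , y₂ ⟫ ∷ ⟪ x₂ , y₁ ⟫ ∷ ⟪ x₂ , y₂ ⟫ ∷ []

    Ind-four-0-extensions : Unique (y ∷ x ∷ x₁ ∷ x₂ ∷ y₁ ∷ y₂ ∷ []) → Ind four-0-extensions
    Ind-four-0-extensions uy@(_ ∷ ux@(_ ∷ ux₁@((x₁≢x₂ ∷ _) ∷ ux₂@(_ ∷ ((y₁≢y₂ ∷ []) ∷ _))))) =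
      0-extension-On (Unique.Unique[x∷xs]⇒x∉xs uy) (there (here refl)) (there (there (here refl))) x₁≢x₂
        (0-extension-On (Unique.Unique[x∷xs]⇒x∉xs ux) (there (there (here refl))) (there (there (there (here refl)))) y₁≢y₂
          (0-extension-On (Unique.Unique[x∷xs]⇒x∉xs ux₁) (there (here refl)) (there (there (here refl))) y₁≢y₂
            (0-extension-On (Unique.Unique[x∷xs]⇒x∉xs ux₂) (here refl) (there (here refl)) y₁≢y₂ Ind-[] [])
            on₂) on₁) on₀
      where
      on₂ = spokes-On {x₂} {y₁ ∷ y₂ ∷ []} id
      on₁ = All.++⁺ (spokes-On {x₁} {y₁ ∷ y₂ ∷ []} there) (On-weaken there on₂)
      on₀ = All.++⁺ (spokes-On {x} {y₁ ∷ y₂ ∷ []} (there ∘ there)) (On-weaken there on₁)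

    -- Both implicit conditions, distinctness of the labels and inclusion of edges, are decided by
    -- evaluation on numerals; a deleted edge is thus settled by naming the six vertices.
    Ind-without : {True (unique? (y ∷ x ∷ x₁ ∷ x₂ ∷ y₁ ∷ y₂ ∷ []))} →
      {True (All.all? (_∈? four-0-extensions) (without (x , y)))} → Ind (without (x , y))
    Ind-without {u} {sub} = Ind-⊆ (without-unique (x , y)) (All.lookup (toWitness sub)) (Ind-four-0-extensions (toWitness u))

  Ind-K33-without : All (Ind ∘ without) K33-edges
  Ind-K33-without =
    Ind-without 0 1 2 3 4 5 ∷ Ind-without 0 1 2 4 3 5 ∷ Ind-without 0 1 2 5 3 4 ∷
    Ind-without 1 0 2 3 4 5 ∷ Ind-without 1 0 2 4 3 5 ∷ Ind-without 1 0 2 5 3 4 ∷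
    Ind-without 2 0 1 3 4 5 ∷ Ind-without 2 0 1 4 3 5 ∷ Ind-without 2 0 1 5 3 4 ∷ []

  -- A proper subgraph misses some edge `e`, hence lies in K₃,₃ minus `e`.
  K33-proper-indep : ∀ D → D ⊆G K33 → ∃[ e ] (K33 e ≡ true × D e ≡ false) → Indep (M F 4) D
  K33-proper-indep D D⊆ (e , e∈ , e∉) = Indep-⊆ (M F 4)
    (λ f f∈ → ∈⇒graph f (∈-without⁺ (toE e) (edge f (D⊆ f f∈)) λ eq →
      true≢false (trans (sym f∈) (trans (cong D (toE-injective eq)) e∉))))
    (indep-at (All.lookup Ind-K33-without (edge e e∈)) 4 (All.tabulate λ p →
      All.lookup K33-edges-within (∈-without⁻ (toE e) p)))
    where
    edge : ∀ f → K33 f ≡ true → toE f ∈ K33-edges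
    edge f p = graph⇒∈ f (trans (sym (K33-graph f)) p)
    true≢false : true ≢ false
    true≢false ()

theorem1p6 : (F : RigidityFamily2) → ¬ EqualsR F → IsCircuit (M F 4) K33
theorem1p6 F F≢R = (λ i → F≢R (Conclusion.K33-indep⇒EqualsR F i)) , Conclusion.K33-proper-indep F
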